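{- For any $A,B,B',C'\in\widehat{\mathbb{F}_q}$, any $x\in\mathbb{F}_q\setminus\{1\}$ and any $y\in\mathbb{F}_q$, $$F_{2}(A;B,B';B,C';x,y)=-\varepsilon(x)\,\overline{A}(1-x)\,{}_{2}F_1\left(\begin{matrix}A,B'\\ C'\end{matrix}\bigg|\,\frac{y}{1-x}\right)+\overline{B}(x)\binom{A\overline{B}}{\overline{B}}\,{}_{2}F_1\left(\begin{matrix}A\overline{B},B'\\ C'\end{matrix}\bigg|\,y\right)$$ $$\qquad+(q-1)\,\delta(A\overline{B})\,\overline{A}(-x)\,\overline{C'}(y)\,\overline{B'}C'(1-y).$$
   Context: Let $q$ be a power of a prime, $\mathbb{F}_q$ the field with $q$ elements, and $\widehat{\mathbb{F}_q}$ the group of (complex-valued) multiplicative characters of $\mathbb{F}_q^*$. Every character $\chi$, including the trivial character $\varepsilon$, is extended to $\mathbb{F}_q$ by $\chi(0)=0$. $\overline{\chi}$ denotes the inverse of $\chi$. Products of characters are evaluated pointwise, e.g. $\overline{B'}C'(1-y)=\overline{B'}(1-y)C'(1-y)$. For a character $\chi$, $\delta(\chi)=1$ if $\chi=\varepsilon$ and $\delta(\chi)=0$ otherwise. Jacobi sum: $J(\chi,\lambda)=\sum_{u\in\mathbb{F}_q}\chi(u)\lambda(1-u)$. Binomial coefficient of characters: $\binom{A}{B}=B(-1)J(A,\overline{B})$. Finite field ${}_2F_1$: for $A,B,C\in\widehat{\mathbb{F}_q}$ and $x\in\mathbb{F}_q$, $${}_{2}F_1\left(\begin{matrix}A,B\\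 C\end{matrix}\bigg|\,x\right)=\varepsilon(x)\,BC(-1)\sum_{u\in\mathbb{F}_q}B(u)\,\overline{B}C(1-u)\,\overline{A}(1-xu).$$ The finite field Appell series $F_2$ is defined, for $A,B,B',C,C'\in\widehat{\mathbb{F}_q}$ and $x,y\in\mathbb{F}_q$, by $$F_{2}(A;B,B';C,C';x,y)=\varepsilon(xy)\,BB'CC'(-1)\sum_{u,v\in\mathbb{F}_q}B(u)B'(v)\,\overline{B}C(1-u)\,\overline{B'}C'(1-v)\,\overline{A}(1-ux-vy).$$ -}

module Defs where

open import Algebra.Bundles using (AbelianGroup; CommutativeRing)
import Algebra.Properties.CommutativeMonoid.Sum as CommutativeMonoidSum
import Algebra.Properties.CommutativeSemigroup as CommutativeSemigroupProperties
import Algebra.Properties.Group as GroupProperties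
import Algebra.Properties.Monoid.Mult as MonoidMult
import Algebra.Properties.Ring as RingProperties
import Algebra.Properties.Semiring.Sum as SemiringSum
open import Algebra.Structures using (IsCommutativeRing)
open import Data.Empty using (⊥-elim)
open import Data.Fin.Base as Fin using (Fin)
open import Data.Fin.Permutation using (Permutation′; permutation; _⟨$⟩ʳ_)
import Data.Fin.Properties as Fin
open import Data.Nat.Base as ℕ using (ℕ)
import Data.Nat.Properties as ℕ
open import Data.Nat.Primality using (Prime)
open import Data.Product.Base using (∃; ∃₂; _×_; _,_; proj₁; proj₂)
open import Data.Rational.Base as ℚ using (ℚ; 0ℚ; 1ℚ; ½)
import Data.Rational.Properties as ℚ
open import Data.Rational.Solver using (module +-*-Solver)
open import Data.Sum.Base using (_⊎_; inj₁; inj₂)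
open import Function.Base using (_∘_)
open import Function.Bundles using (Inverse)
open import Level using (Level; suc; _⊔_)
import Relation.Binary.PropositionalEquality as ≡
open ≡ using (_≡_)
import Relation.Binary.Reasoning.Setoid as SetoidReasoning
open import Relation.Binary.Structures using (IsEquivalence)
open import Relation.Nullary.Decidable using (Dec; yes; no; from-yes; from-no; map′)
open import Relation.Nullary.Negation using (¬_)

private
  half+half : ∀ ε → ½ ℚ.* ε ℚ.+ ½ ℚ.* ε ≡ ε
  half+half ε = ≡.trans (≡.sym (ℚ.*-distribʳ-+ ε ½ ½)) (ℚ.*-identityˡ ε)

  half-pos : ∀ {ε} → 0ℚ ℚ.< ε → 0ℚ ℚ.< ½ ℚ.* ε
  half-pos {ε} 0<ε = ℚ.positive⁻¹ (½ ℚ.* ε)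
    where instance
      _ = ℚ.positive 0<ε
      _ = ℚ.pos*pos⇒pos ½ ε

  ∣p-p∣≤ : ∀ {ε} p → 0ℚ ℚ.< ε → ℚ.∣ p ℚ.- p ∣ ℚ.≤ ε
  ∣p-p∣≤ p 0<ε rewrite ℚ.+-inverseʳ p = ℚ.<⇒≤ 0<ε

  ∣p-q∣≡∣q-p∣ : ∀ p q → ℚ.∣ p ℚ.- q ∣ ≡ ℚ.∣ q ℚ.- p ∣
  ∣p-q∣≡∣q-p∣ p q = ≡.trans (≡.sym (ℚ.∣-p∣≡∣p∣ (p ℚ.- q)))
    (≡.cong ℚ.∣_∣ (solve 2 (λ p q → :- (p :- q) := q :- p) ≡.refl p q))
    where open +-*-Solver

  ∣sum∣≤ : ∀ {ε} p q r → p ≡ q ℚ.+ r →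
           ℚ.∣ q ∣ ℚ.≤ ½ ℚ.* ε → ℚ.∣ r ∣ ℚ.≤ ½ ℚ.* ε → ℚ.∣ p ∣ ℚ.≤ ε
  ∣sum∣≤ {ε} _ q r ≡.refl hq hr = begin
    ℚ.∣ q ℚ.+ r ∣          ≤⟨ ℚ.∣p+q∣≤∣p∣+∣q∣ q r ⟩
    ℚ.∣ q ∣ ℚ.+ ℚ.∣ r ∣    ≤⟨ ℚ.+-mono-≤ hq hr ⟩
    ½ ℚ.* ε ℚ.+ ½ ℚ.* ε    ≡⟨ half+half ε ⟩
    ε                      ∎
    where open ℚ.≤-Reasoning

  split : ∀ p q r → p ℚ.- r ≡ (p ℚ.- q) ℚ.+ (q ℚ.- r)
  split = solve 3 (λ p q r → p :- r := (p :- q) :+ (q :- r)) ≡.refl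
    where open +-*-Solver

  ∣∣*∣∣-mono : ∀ p q {M δ} → ℚ.∣ p ∣ ℚ.≤ M → ℚ.∣ q ∣ ℚ.≤ δ → ℚ.∣ p ℚ.* q ∣ ℚ.≤ M ℚ.* δ
  ∣∣*∣∣-mono p q {M} {δ} hp hq = begin
    ℚ.∣ p ℚ.* q ∣          ≡⟨ ℚ.∣p*q∣≡∣p∣*∣q∣ p q ⟩
    ℚ.∣ p ∣ ℚ.* ℚ.∣ q ∣    ≤⟨ ℚ.*-monoˡ-≤-nonNeg ℚ.∣ p ∣ {{ℚ.∣-∣-nonNeg p}} hq ⟩
    ℚ.∣ p ∣ ℚ.* δ          ≤⟨ ℚ.*-monoʳ-≤-nonNeg δ {{0≤δ}} hp ⟩
    M ℚ.* δ                ∎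
    where
    open ℚ.≤-Reasoning
    0≤δ = ℚ.nonNegative (ℚ.≤-trans (ℚ.0≤∣p∣ q) hq)

  scale : ∀ {M ε} → 0ℚ ℚ.< M → 0ℚ ℚ.< ε → ∃ λ δ → 0ℚ ℚ.< δ × M ℚ.* δ ≡ ε
  scale {M} {ε} 0<M 0<ε = M⁻¹ ℚ.* ε , ℚ.positive⁻¹ (M⁻¹ ℚ.* ε) , (begin
    M ℚ.* (M⁻¹ ℚ.* ε)    ≡⟨ ℚ.*-assoc M M⁻¹ ε ⟨
    M ℚ.* M⁻¹ ℚ.* ε      ≡⟨ ≡.cong (ℚ._* ε) (ℚ.*-inverseʳ M) ⟩
    1ℚ ℚ.* ε             ≡⟨ ℚ.*-identityˡ ε ⟩
    ε                    ∎)
    where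
    open ≡.≡-Reasoning
    instance
      _ = ℚ.positive 0<M
      _ = ℚ.positive 0<ε
      _ = ℚ.pos⇒nonZero M
    M⁻¹ = ℚ.1/ M
    instance
      _ = ℚ.1/pos⇒pos M
      _ = ℚ.pos*pos⇒pos M⁻¹ ε

  *-close : ∀ {M ε} → 0ℚ ℚ.< M → 0ℚ ℚ.< ε → ∃ λ δ → 0ℚ ℚ.< δ ×
            (∀ p q p′ q′ → ℚ.∣ p ∣ ℚ.≤ M → ℚ.∣ q′ ∣ ℚ.≤ M →
             ℚ.∣ p ℚ.- p′ ∣ ℚ.≤ δ → ℚ.∣ q ℚ.- q′ ∣ ℚ.≤ δ →
             ℚ.∣ p ℚ.* q ℚ.- p′ ℚ.* q′ ∣ ℚ.≤ ε)
  *-close {M} {ε} 0<M 0<ε with scale 0<M (half-pos 0<ε)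
  ... | δ , 0<δ , Mδ≡ε/2 = δ , 0<δ , λ p q p′ q′ hp hq′ hpp′ hqq′ →
    ∣sum∣≤ _ (p ℚ.* (q ℚ.- q′)) (q′ ℚ.* (p ℚ.- p′))
      (solve 4 (λ p q p′ q′ → p :* q :- p′ :* q′ := p :* (q :- q′) :+ q′ :* (p :- p′))
        ≡.refl p q p′ q′)
      (≡.subst (_ ℚ.≤_) Mδ≡ε/2 (∣∣*∣∣-mono p (q ℚ.- q′) hp hqq′))
      (≡.subst (_ ℚ.≤_) Mδ≡ε/2 (∣∣*∣∣-mono q′ (p ℚ.- p′) hq′ hpp′))
    where open +-*-Solver

Eventually : (ℕ → Set) → Set
Eventually P = ∃ λ N → ∀ n → N ℕ.≤ n → P n

-- Cauchy sequences of rationals; two are identified by _≈ᴿ_ when their difference tends to 0.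
record ℝ : Set where
  constructor mkℝ
  field
    seq    : ℕ → ℚ
    cauchy : ∀ ε → 0ℚ ℚ.< ε → ∃ λ N → ∀ m n → N ℕ.≤ m → N ℕ.≤ n →
             ℚ.∣ seq m ℚ.- seq n ∣ ℚ.≤ ε

open ℝ public

infix 4 _≈ᴿ_

record _≈ᴿ_ (x y : ℝ) : Set where
  constructor mk≈ᴿ
  field
    close : ∀ ε → 0ℚ ℚ.< ε → Eventually λ n → ℚ.∣ seq x n ℚ.- seq y n ∣ ℚ.≤ ε

open _≈ᴿ_ public

eventually-× : ∀ {P Q} → Eventually P → Eventually Q → Eventually (λ n → P n × Q n)
eventually-× (M , p) (N , q) = M ℕ.⊔ N , λ n M⊔N≤n →
  p n (ℕ.m⊔n≤o⇒m≤o M N M⊔N≤n) , q n (ℕ.m⊔n≤o⇒n≤o M N M⊔N≤n)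

eventually-map : ∀ {P Q : ℕ → Set} → (∀ n → P n → Q n) → Eventually P → Eventually Q
eventually-map f (N , p) = N , λ n N≤n → f n (p n N≤n)

≗⇒≈ᴿ : ∀ {x y} → (∀ n → seq x n ≡ seq y n) → x ≈ᴿ y
≗⇒≈ᴿ {x} {y} x≗y = mk≈ᴿ λ ε 0<ε → 0 , λ n _ →
  ≡.subst (λ p → ℚ.∣ p ℚ.- seq y n ∣ ℚ.≤ ε) (≡.sym (x≗y n)) (∣p-p∣≤ (seq y n) 0<ε)

private
  bounded-above : ∀ {ε} → 0ℚ ℚ.< ε → ∀ x →
                  ∃ λ M → 0ℚ ℚ.< M × Eventually λ n → ℚ.∣ seq x n ∣ ℚ.≤ M
  bounded-above {ε} 0<ε x with cauchy x ε 0<ε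
  ... | N , h = ε ℚ.+ ℚ.∣ seq x N ∣
    , ℚ.<-≤-trans 0<ε
        (≡.subst (ℚ._≤ ε ℚ.+ ℚ.∣ seq x N ∣) (ℚ.+-identityʳ ε) (ℚ.+-monoʳ-≤ ε (ℚ.0≤∣p∣ (seq x N))))
    , N , λ n N≤n → begin
        ℚ.∣ seq x n ∣                                   ≡⟨ ≡.cong ℚ.∣_∣ (eq (seq x n) (seq x N)) ⟩
        ℚ.∣ (seq x n ℚ.- seq x N) ℚ.+ seq x N ∣         ≤⟨ ℚ.∣p+q∣≤∣p∣+∣q∣ (seq x n ℚ.- seq x N) (seq x N) ⟩
        ℚ.∣ seq x n ℚ.- seq x N ∣ ℚ.+ ℚ.∣ seq x N ∣     ≤⟨ ℚ.+-monoˡ-≤ ℚ.∣ seq x N ∣ (h n N N≤n ℕ.≤-refl) ⟩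
        ε ℚ.+ ℚ.∣ seq x N ∣                             ∎
    where
    open ℚ.≤-Reasoning
    open +-*-Solver
    eq : ∀ p q → p ≡ (p ℚ.- q) ℚ.+ q
    eq = solve 2 (λ p q → p := (p :- q) :+ q) ≡.refl

  bounded : ∀ x → ∃ λ M → 0ℚ ℚ.< M × Eventually λ n → ℚ.∣ seq x n ∣ ℚ.≤ M
  bounded = bounded-above (ℚ.positive⁻¹ 1ℚ)

  common-bound : ∀ x y → ∃ λ M → 0ℚ ℚ.< M ×
                 Eventually λ n → ℚ.∣ seq x n ∣ ℚ.≤ M × ℚ.∣ seq y n ∣ ℚ.≤ M
  common-bound x y = join (bounded x) (bounded y)
    where
    join : (∃ λ K → 0ℚ ℚ.< K × Eventually λ n → ℚ.∣ seq x n ∣ ℚ.≤ K) →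
           (∃ λ L → 0ℚ ℚ.< L × Eventually λ n → ℚ.∣ seq y n ∣ ℚ.≤ L) →
           ∃ λ M → 0ℚ ℚ.< M × Eventually λ n → ℚ.∣ seq x n ∣ ℚ.≤ M × ℚ.∣ seq y n ∣ ℚ.≤ M
    join (K , 0<K , M , hx) (L , 0<L , N , hy) = K ℚ.⊔ L , ℚ.<-≤-trans 0<K (ℚ.p≤p⊔q K L)
      , M ℕ.⊔ N , λ n M⊔N≤n →
          ℚ.≤-trans (hx n (ℕ.m⊔n≤o⇒m≤o M N M⊔N≤n)) (ℚ.p≤p⊔q K L)
        , ℚ.≤-trans (hy n (ℕ.m⊔n≤o⇒n≤o M N M⊔N≤n)) (ℚ.p≤q⊔p K L)

  +-diff : ∀ p q p′ q′ → (p ℚ.+ q) ℚ.- (p′ ℚ.+ q′) ≡ (p ℚ.- p′) ℚ.+ (q ℚ.- q′)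
  +-diff = solve 4 (λ p q p′ q′ → (p :+ q) :- (p′ :+ q′) := (p :- p′) :+ (q :- q′)) ≡.refl
    where open +-*-Solver

  ∣neg-diff∣ : ∀ p q → ℚ.∣ ℚ.- p ℚ.- ℚ.- q ∣ ≡ ℚ.∣ p ℚ.- q ∣
  ∣neg-diff∣ p q = ≡.trans (≡.cong ℚ.∣_∣ (≡.sym (ℚ.neg-distrib-+ p (ℚ.- q)))) (ℚ.∣-p∣≡∣p∣ (p ℚ.- q))

-- Opaque to keep unification from unfolding arithmetic on ℝ and ℂ down to sequences of rationals.
infixl 6 _+ᴿ_
infixl 7 _*ᴿ_
infix  8 -ᴿ_

opaque
  fromℚ : ℚ → ℝ
  fromℚ p = mkℝ (λ _ → p) λ ε 0<ε → 0 , λ _ _ _ _ → ∣p-p∣≤ p 0<ε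

  _+ᴿ_ : ℝ → ℝ → ℝ
  x +ᴿ y = mkℝ (λ n → seq x n ℚ.+ seq y n) λ ε 0<ε →
    let K , hx = cauchy x (½ ℚ.* ε) (half-pos 0<ε)
        L , hy = cauchy y (½ ℚ.* ε) (half-pos 0<ε)
    in K ℕ.⊔ L , λ m n hm hn →
       ∣sum∣≤ _ _ _ (+-diff (seq x m) (seq y m) (seq x n) (seq y n))
         (hx m n (ℕ.m⊔n≤o⇒m≤o K L hm) (ℕ.m⊔n≤o⇒m≤o K L hn))
         (hy m n (ℕ.m⊔n≤o⇒n≤o K L hm) (ℕ.m⊔n≤o⇒n≤o K L hn))

  -ᴿ_ : ℝ → ℝ
  -ᴿ x = mkℝ (λ n → ℚ.- seq x n) λ ε 0<ε →
    let N , h = cauchy x ε 0<ε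
    in N , λ m n hm hn →
       ≡.subst (ℚ._≤ ε) (≡.sym (∣neg-diff∣ (seq x m) (seq x n))) (h m n hm hn)

  _*ᴿ_ : ℝ → ℝ → ℝ
  x *ᴿ y = mkℝ (λ n → seq x n ℚ.* seq y n) λ ε 0<ε →
    let M , 0<M , B , bound = common-bound x y
        δ , 0<δ , close = *-close 0<M 0<ε
        K , hx = cauchy x δ 0<δ
        L , hy = cauchy y δ 0<δ
    in B ℕ.⊔ (K ℕ.⊔ L) , λ m n hm hn →
       let hm′ = ℕ.m⊔n≤o⇒n≤o B _ hm
           hn′ = ℕ.m⊔n≤o⇒n≤o B _ hn
       in close (seq x m) (seq y m) (seq x n) (seq y n)
            (proj₁ (bound m (ℕ.m⊔n≤o⇒m≤o B _ hm)))
            (proj₂ (bound n (ℕ.m⊔n≤o⇒m≤o B _ hn)))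
            (hx m n (ℕ.m⊔n≤o⇒m≤o K L hm′) (ℕ.m⊔n≤o⇒m≤o K L hn′))
            (hy m n (ℕ.m⊔n≤o⇒n≤o K L hm′) (ℕ.m⊔n≤o⇒n≤o K L hn′))

≈ᴿ-refl : ∀ {x} → x ≈ᴿ x
≈ᴿ-refl = ≗⇒≈ᴿ λ _ → ≡.refl

≈ᴿ-sym : ∀ {x y} → x ≈ᴿ y → y ≈ᴿ x
≈ᴿ-sym {x} {y} h = mk≈ᴿ λ ε 0<ε → eventually-map
  (λ n → ≡.subst (ℚ._≤ ε) (∣p-q∣≡∣q-p∣ (seq x n) (seq y n))) (close h ε 0<ε)

≈ᴿ-trans : ∀ {x y z} → x ≈ᴿ y → y ≈ᴿ z → x ≈ᴿ z
≈ᴿ-trans {x} {y} {z} h k = mk≈ᴿ λ ε 0<ε → eventually-map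
  (λ n (p , q) → ∣sum∣≤ _ _ _ (split (seq x n) (seq y n) (seq z n)) p q)
  (eventually-× (close h _ (half-pos 0<ε)) (close k _ (half-pos 0<ε)))

opaque
  unfolding _+ᴿ_

  +ᴿ-cong : ∀ {x y u v} → x ≈ᴿ y → u ≈ᴿ v → x +ᴿ u ≈ᴿ y +ᴿ v
  +ᴿ-cong {x} {y} {u} {v} h k = mk≈ᴿ λ ε 0<ε → eventually-map
    (λ n (p , q) → ∣sum∣≤ _ _ _ (+-diff (seq x n) (seq u n) (seq y n) (seq v n)) p q)
    (eventually-× (close h _ (half-pos 0<ε)) (close k _ (half-pos 0<ε)))

  -ᴿ-cong : ∀ {x y} → x ≈ᴿ y → -ᴿ x ≈ᴿ -ᴿ y
  -ᴿ-cong {x} {y} h = mk≈ᴿ λ ε 0<ε → eventually-map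
    (λ n → ≡.subst (ℚ._≤ ε) (≡.sym (∣neg-diff∣ (seq x n) (seq y n)))) (close h ε 0<ε)

  *ᴿ-cong : ∀ {x y u v} → x ≈ᴿ y → u ≈ᴿ v → x *ᴿ u ≈ᴿ y *ᴿ v
  *ᴿ-cong {x} {y} {u} {v} h k = mk≈ᴿ λ ε 0<ε →
    let M , 0<M , bound = common-bound x v
        δ , 0<δ , product = *-close 0<M 0<ε
    in eventually-map
         (λ n ((bx , bv) , p , q) → product (seq x n) (seq u n) (seq y n) (seq v n) bx bv p q)
         (eventually-× bound (eventually-× (close h δ 0<δ) (close k δ 0<δ)))

≈ᴿ-isEquivalence : IsEquivalence _≈ᴿ_
≈ᴿ-isEquivalence = record { refl = ≈ᴿ-refl ; sym = ≈ᴿ-sym ; trans = ≈ᴿ-trans }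

opaque
  unfolding _+ᴿ_

  ℝ-isCommutativeRing : IsCommutativeRing _≈ᴿ_ _+ᴿ_ _*ᴿ_ -ᴿ_ (fromℚ 0ℚ) (fromℚ 1ℚ)
  ℝ-isCommutativeRing = record
    { isRing = record
      { +-isAbelianGroup = record
        { isGroup = record
          { isMonoid = record
            { isSemigroup = record
              { isMagma = record { isEquivalence = ≈ᴿ-isEquivalence ; ∙-cong = +ᴿ-cong }
              ; assoc = λ x y z → ≗⇒≈ᴿ λ n → ℚ.+-assoc (seq x n) (seq y n) (seq z n)
              }
            ; identity = (λ x → ≗⇒≈ᴿ λ n → ℚ.+-identityˡ (seq x n))
                       , (λ x → ≗⇒≈ᴿ λ n → ℚ.+-identityʳ (seq x n))
            }
          ; inverse = (λ x → ≗⇒≈ᴿ λ n → ℚ.+-inverseˡ (seq x n))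
                    , (λ x → ≗⇒≈ᴿ λ n → ℚ.+-inverseʳ (seq x n))
          ; ⁻¹-cong = -ᴿ-cong
          }
        ; comm = λ x y → ≗⇒≈ᴿ λ n → ℚ.+-comm (seq x n) (seq y n)
        }
      ; *-cong = *ᴿ-cong
      ; *-assoc = λ x y z → ≗⇒≈ᴿ λ n → ℚ.*-assoc (seq x n) (seq y n) (seq z n)
      ; *-identity = (λ x → ≗⇒≈ᴿ λ n → ℚ.*-identityˡ (seq x n))
                   , (λ x → ≗⇒≈ᴿ λ n → ℚ.*-identityʳ (seq x n))
      ; distrib = (λ x y z → ≗⇒≈ᴿ λ n → ℚ.*-distribˡ-+ (seq x n) (seq y n) (seq z n))
                , (λ x y z → ≗⇒≈ᴿ λ n → ℚ.*-distribʳ-+ (seq x n) (seq y n) (seq z n))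
      }
    ; *-comm = λ x y → ≗⇒≈ᴿ λ n → ℚ.*-comm (seq x n) (seq y n)
    }

ℝ-commutativeRing : CommutativeRing _ _
ℝ-commutativeRing = record { isCommutativeRing = ℝ-isCommutativeRing }

record ℂ : Set where
  constructor _+i_
  field
    re : ℝ
    im : ℝ

open ℂ public

infix 4 _≈ℂ_

record _≈ℂ_ (z w : ℂ) : Set where
  constructor mk≈ℂ
  field
    re≈ : re z ≈ᴿ re w
    im≈ : im z ≈ᴿ im w

open _≈ℂ_ public

infixl 6 _+ℂ_ _-ℂ_
infixl 7 _*ℂ_
infix  8 -ℂ_

opaque
  0ℂ 1ℂ : ℂ
  0ℂ = fromℚ 0ℚ +i fromℚ 0ℚ
  1ℂ = fromℚ 1ℚ +i fromℚ 0ℚ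

  _+ℂ_ _*ℂ_ : ℂ → ℂ → ℂ
  z +ℂ w = (re z +ᴿ re w) +i (im z +ᴿ im w)
  z *ℂ w = (re z *ᴿ re w +ᴿ -ᴿ (im z *ᴿ im w)) +i (re z *ᴿ im w +ᴿ im z *ᴿ re w)

  -ℂ_ : ℂ → ℂ
  -ℂ z = (-ᴿ re z) +i (-ᴿ im z)

_-ℂ_ : ℂ → ℂ → ℂ
z -ℂ w = z +ℂ -ℂ w

private
  module ℝR = CommutativeRing ℝ-commutativeRing

  ≗⇒≈ℂ : ∀ {z w} → (∀ n → seq (re z) n ≡ seq (re w) n) →
          (∀ n → seq (im z) n ≡ seq (im w) n) → z ≈ℂ w
  ≗⇒≈ℂ f g = mk≈ℂ (≗⇒≈ᴿ f) (≗⇒≈ᴿ g)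

  module _ where
    open +-*-Solver

    *-assoc-re : ∀ a b c d e f →
      (a ℚ.* c ℚ.+ ℚ.- (b ℚ.* d)) ℚ.* e ℚ.+ ℚ.- ((a ℚ.* d ℚ.+ b ℚ.* c) ℚ.* f) ≡
      a ℚ.* (c ℚ.* e ℚ.+ ℚ.- (d ℚ.* f)) ℚ.+ ℚ.- (b ℚ.* (c ℚ.* f ℚ.+ d ℚ.* e))
    *-assoc-re = solve 6 (λ a b c d e f →
      (a :* c :+ :- (b :* d)) :* e :+ :- ((a :* d :+ b :* c) :* f) :=
      a :* (c :* e :+ :- (d :* f)) :+ :- (b :* (c :* f :+ d :* e))) ≡.refl

    *-assoc-im : ∀ a b c d e f →
      (a ℚ.* c ℚ.+ ℚ.- (b ℚ.* d)) ℚ.* f ℚ.+ (a ℚ.* d ℚ.+ b ℚ.* c) ℚ.* e ≡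
      a ℚ.* (c ℚ.* f ℚ.+ d ℚ.* e) ℚ.+ b ℚ.* (c ℚ.* e ℚ.+ ℚ.- (d ℚ.* f))
    *-assoc-im = solve 6 (λ a b c d e f →
      (a :* c :+ :- (b :* d)) :* f :+ (a :* d :+ b :* c) :* e :=
      a :* (c :* f :+ d :* e) :+ b :* (c :* e :+ :- (d :* f))) ≡.refl

    *-comm-re : ∀ a b c d → a ℚ.* c ℚ.+ ℚ.- (b ℚ.* d) ≡ c ℚ.* a ℚ.+ ℚ.- (d ℚ.* b)
    *-comm-re = solve 4 (λ a b c d →
      a :* c :+ :- (b :* d) := c :* a :+ :- (d :* b)) ≡.refl

    *-comm-im : ∀ a b c d → a ℚ.* d ℚ.+ b ℚ.* c ≡ c ℚ.* b ℚ.+ d ℚ.* a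
    *-comm-im = solve 4 (λ a b c d → a :* d :+ b :* c := c :* b :+ d :* a) ≡.refl

    distribˡ-re : ∀ a b c d e f →
      a ℚ.* (c ℚ.+ e) ℚ.+ ℚ.- (b ℚ.* (d ℚ.+ f)) ≡
      (a ℚ.* c ℚ.+ ℚ.- (b ℚ.* d)) ℚ.+ (a ℚ.* e ℚ.+ ℚ.- (b ℚ.* f))
    distribˡ-re = solve 6 (λ a b c d e f →
      a :* (c :+ e) :+ :- (b :* (d :+ f)) :=
      (a :* c :+ :- (b :* d)) :+ (a :* e :+ :- (b :* f))) ≡.refl

    distribˡ-im : ∀ a b c d e f →
      a ℚ.* (d ℚ.+ f) ℚ.+ b ℚ.* (c ℚ.+ e) ≡
      (a ℚ.* d ℚ.+ b ℚ.* c) ℚ.+ (a ℚ.* f ℚ.+ b ℚ.* e)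
    distribˡ-im = solve 6 (λ a b c d e f →
      a :* (d :+ f) :+ b :* (c :+ e) :=
      (a :* d :+ b :* c) :+ (a :* f :+ b :* e)) ≡.refl

  ≈ℂ-isEquivalence : IsEquivalence _≈ℂ_
  ≈ℂ-isEquivalence = record
    { refl  = mk≈ℂ ≈ᴿ-refl ≈ᴿ-refl
    ; sym   = λ (mk≈ℂ p q) → mk≈ℂ (≈ᴿ-sym p) (≈ᴿ-sym q)
    ; trans = λ (mk≈ℂ p q) (mk≈ℂ p′ q′) → mk≈ℂ (≈ᴿ-trans p p′) (≈ᴿ-trans q q′)
    }

  ≈ℂ-trans : ∀ {z w v} → z ≈ℂ w → w ≈ℂ v → z ≈ℂ v
  ≈ℂ-trans = IsEquivalence.trans ≈ℂ-isEquivalence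

opaque
  unfolding _+ᴿ_ _+ℂ_

  *ℂ-comm : ∀ z w → z *ℂ w ≈ℂ w *ℂ z
  *ℂ-comm (a +i b) (c +i d) = ≗⇒≈ℂ
    (λ n → *-comm-re (seq a n) (seq b n) (seq c n) (seq d n))
    (λ n → *-comm-im (seq a n) (seq b n) (seq c n) (seq d n))

  *ℂ-assoc : ∀ z w v → (z *ℂ w) *ℂ v ≈ℂ z *ℂ (w *ℂ v)
  *ℂ-assoc (a +i b) (c +i d) (e +i f) = ≗⇒≈ℂ
    (λ n → *-assoc-re (seq a n) (seq b n) (seq c n) (seq d n) (seq e n) (seq f n))
    (λ n → *-assoc-im (seq a n) (seq b n) (seq c n) (seq d n) (seq e n) (seq f n))

  *ℂ-distribˡ : ∀ z w v → z *ℂ (w +ℂ v) ≈ℂ z *ℂ w +ℂ z *ℂ v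
  *ℂ-distribˡ (a +i b) (c +i d) (e +i f) = ≗⇒≈ℂ
    (λ n → distribˡ-re (seq a n) (seq b n) (seq c n) (seq d n) (seq e n) (seq f n))
    (λ n → distribˡ-im (seq a n) (seq b n) (seq c n) (seq d n) (seq e n) (seq f n))

opaque
  unfolding _+ℂ_

  *ℂ-identityˡ : ∀ z → 1ℂ *ℂ z ≈ℂ z
  *ℂ-identityˡ (a +i b) = mk≈ℂ
    (begin
      one *ᴿ a +ᴿ -ᴿ (nil *ᴿ b)  ≈⟨ ℝR.+-cong (ℝR.*-identityˡ a) (ℝR.-‿cong (ℝR.zeroˡ b)) ⟩
      a +ᴿ -ᴿ nil                ≈⟨ ℝR.+-congˡ {a} -0#≈0# ⟩
      a +ᴿ nil                   ≈⟨ ℝR.+-identityʳ a ⟩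
      a                          ∎)
    (begin
      one *ᴿ b +ᴿ nil *ᴿ a  ≈⟨ ℝR.+-cong (ℝR.*-identityˡ b) (ℝR.zeroˡ a) ⟩
      b +ᴿ nil              ≈⟨ ℝR.+-identityʳ b ⟩
      b                     ∎)
    where
    open SetoidReasoning ℝR.setoid
    open RingProperties ℝR.ring using (-0#≈0#)
    one nil : ℝ
    one = fromℚ 1ℚ
    nil = fromℚ 0ℚ

  +ℂ-cong : ∀ {z w u v} → z ≈ℂ w → u ≈ℂ v → z +ℂ u ≈ℂ w +ℂ v
  +ℂ-cong (mk≈ℂ p q) (mk≈ℂ p′ q′) = mk≈ℂ (ℝR.+-cong p p′) (ℝR.+-cong q q′)

  *ℂ-cong : ∀ {z w u v} → z ≈ℂ w → u ≈ℂ v → z *ℂ u ≈ℂ w *ℂ v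
  *ℂ-cong (mk≈ℂ p q) (mk≈ℂ p′ q′) = mk≈ℂ
    (ℝR.+-cong (ℝR.*-cong p p′) (ℝR.-‿cong (ℝR.*-cong q q′)))
    (ℝR.+-cong (ℝR.*-cong p q′) (ℝR.*-cong q p′))

  ℂ-isCommutativeRing : IsCommutativeRing _≈ℂ_ _+ℂ_ _*ℂ_ -ℂ_ 0ℂ 1ℂ
  ℂ-isCommutativeRing = record
    { isRing = record
      { +-isAbelianGroup = record
        { isGroup = record
          { isMonoid = record
            { isSemigroup = record
              { isMagma = record { isEquivalence = ≈ℂ-isEquivalence ; ∙-cong = +ℂ-cong }
              ; assoc = λ z w v → mk≈ℂ (ℝR.+-assoc (re z) (re w) (re v)) (ℝR.+-assoc (im z) (im w) (im v))
              }
            ; identity = (λ z → mk≈ℂ (ℝR.+-identityˡ (re z)) (ℝR.+-identityˡ (im z)))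
                       , (λ z → mk≈ℂ (ℝR.+-identityʳ (re z)) (ℝR.+-identityʳ (im z)))
            }
          ; inverse = (λ z → mk≈ℂ (ℝR.-‿inverseˡ (re z)) (ℝR.-‿inverseˡ (im z)))
                    , (λ z → mk≈ℂ (ℝR.-‿inverseʳ (re z)) (ℝR.-‿inverseʳ (im z)))
          ; ⁻¹-cong = λ (mk≈ℂ p q) → mk≈ℂ (ℝR.-‿cong p) (ℝR.-‿cong q)
          }
        ; comm = λ z w → mk≈ℂ (ℝR.+-comm (re z) (re w)) (ℝR.+-comm (im z) (im w))
        }
      ; *-cong = *ℂ-cong
      ; *-assoc = *ℂ-assoc
      ; *-identity = *ℂ-identityˡ
                   , λ z → ≈ℂ-trans (*ℂ-comm z 1ℂ) (*ℂ-identityˡ z)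
      ; distrib = *ℂ-distribˡ
                , λ z w v → ≈ℂ-trans (*ℂ-comm (w +ℂ v) z)
                    (≈ℂ-trans (*ℂ-distribˡ z w v) (+ℂ-cong (*ℂ-comm z w) (*ℂ-comm z v)))
      }
    ; *-comm = *ℂ-comm
    }

ℂ-commutativeRing : CommutativeRing _ _
ℂ-commutativeRing = record { isCommutativeRing = ℂ-isCommutativeRing }

private
  ∣p-q∣≤⇒p≤q+ : ∀ {p q ε} → ℚ.∣ p ℚ.- q ∣ ℚ.≤ ε → p ℚ.≤ q ℚ.+ ε
  ∣p-q∣≤⇒p≤q+ {p} {q} {ε} h = begin
    p                        ≡⟨ eq p q ⟩
    q ℚ.+ (p ℚ.- q)          ≤⟨ ℚ.+-monoʳ-≤ q (≤∣∣ (p ℚ.- q)) ⟩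
    q ℚ.+ ℚ.∣ p ℚ.- q ∣      ≤⟨ ℚ.+-monoʳ-≤ q h ⟩
    q ℚ.+ ε                  ∎
    where
    open ℚ.≤-Reasoning
    eq : ∀ p q → p ≡ q ℚ.+ (p ℚ.- q)
    eq = solve 2 (λ p q → p := q :+ (p :- q)) ≡.refl
      where open +-*-Solver
    ≤∣∣ : ∀ p → p ℚ.≤ ℚ.∣ p ∣
    ≤∣∣ p with ℚ.≤-total 0ℚ p
    ... | inj₁ 0≤p = ℚ.≤-reflexive (≡.sym (ℚ.0≤p⇒∣p∣≡p 0≤p))
    ... | inj₂ p≤0 = ℚ.≤-trans p≤0 (ℚ.0≤∣p∣ p)

  p-0≡p : ∀ p → p ℚ.- 0ℚ ≡ p
  p-0≡p = ℚ.+-identityʳ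

  0≤p² : ∀ p → 0ℚ ℚ.≤ p ℚ.* p
  0≤p² p with ℚ.≤-total 0ℚ p
  ... | inj₁ 0≤p = ℚ.nonNegative⁻¹ (p ℚ.* p)
      {{ℚ.nonNeg*nonNeg⇒nonNeg p {{ℚ.nonNegative 0≤p}} p {{ℚ.nonNegative 0≤p}}}}
  ... | inj₂ p≤0 = ≡.subst (ℚ._≤ p ℚ.* p) (ℚ.*-zeroˡ p)
      (ℚ.*-monoʳ-≤-nonPos p {{ℚ.nonPositive p≤0}} p≤0)

opaque
  unfolding _+ᴿ_

  *ᴿ-cancel : ∀ {c x y} → 0ℚ ℚ.< c → Eventually (λ n → c ℚ.≤ seq x n) →
              x *ᴿ y ≈ᴿ fromℚ 0ℚ → y ≈ᴿ fromℚ 0ℚ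
  *ᴿ-cancel {c} {x} {y} 0<c c≤x xy≈0 = mk≈ᴿ λ ε 0<ε → eventually-map
    (λ n (c≤xₙ , h) → let xₙ = seq x n ; yₙ = seq y n in
      ≡.subst (λ p → ℚ.∣ p ∣ ℚ.≤ ε) (≡.sym (p-0≡p yₙ))
        (ℚ.*-cancelˡ-≤-pos c (begin
          c ℚ.* ℚ.∣ yₙ ∣               ≤⟨ ℚ.*-monoʳ-≤-nonNeg ℚ.∣ yₙ ∣ {{ℚ.∣-∣-nonNeg yₙ}} c≤xₙ ⟩
          xₙ ℚ.* ℚ.∣ yₙ ∣              ≡⟨ ≡.cong (ℚ._* ℚ.∣ yₙ ∣)
                                            (ℚ.0≤p⇒∣p∣≡p (ℚ.≤-trans (ℚ.<⇒≤ 0<c) c≤xₙ)) ⟨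
          ℚ.∣ xₙ ∣ ℚ.* ℚ.∣ yₙ ∣        ≡⟨ ℚ.∣p*q∣≡∣p∣*∣q∣ xₙ yₙ ⟨
          ℚ.∣ xₙ ℚ.* yₙ ∣              ≡⟨ ≡.cong ℚ.∣_∣ (p-0≡p (xₙ ℚ.* yₙ)) ⟨
          ℚ.∣ xₙ ℚ.* yₙ ℚ.- 0ℚ ∣       ≤⟨ h ⟩
          c ℚ.* ε                      ∎)))
    (eventually-× c≤x (close xy≈0 (c ℚ.* ε) (cε>0 0<ε)))
    where
    open ℚ.≤-Reasoning
    instance
      c⁺ : ℚ.Positive c
      c⁺ = ℚ.positive 0<c
    cε>0 : ∀ {ε} → 0ℚ ℚ.< ε → 0ℚ ℚ.< c ℚ.* ε
    cε>0 {ε} 0<ε = ℚ.positive⁻¹ (c ℚ.* ε) {{ℚ.pos*pos⇒pos c ε {{ℚ.positive 0<ε}}}}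

private
  norm-re : ∀ a b u v → (a ℚ.* a ℚ.+ b ℚ.* b) ℚ.* u ≡
            a ℚ.* (a ℚ.* u ℚ.+ ℚ.- (b ℚ.* v)) ℚ.+ b ℚ.* (a ℚ.* v ℚ.+ b ℚ.* u)
  norm-re = solve 4 (λ a b u v → (a :* a :+ b :* b) :* u :=
    a :* (a :* u :+ :- (b :* v)) :+ b :* (a :* v :+ b :* u)) ≡.refl
    where open +-*-Solver

  norm-im : ∀ a b u v → (a ℚ.* a ℚ.+ b ℚ.* b) ℚ.* v ≡
            a ℚ.* (a ℚ.* v ℚ.+ b ℚ.* u) ℚ.+ b ℚ.* (ℚ.- (a ℚ.* u ℚ.+ ℚ.- (b ℚ.* v)))
  norm-im = solve 4 (λ a b u v → (a :* a :+ b :* b) :* v :=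
    a :* (a :* v :+ b :* u) :+ b :* (:- (a :* u :+ :- (b :* v)))) ≡.refl
    where open +-*-Solver

opaque
  unfolding _+ᴿ_

  private
    norm-reᴿ : ∀ a b u v → (a *ᴿ a +ᴿ b *ᴿ b) *ᴿ u ≈ᴿ
               a *ᴿ (a *ᴿ u +ᴿ -ᴿ (b *ᴿ v)) +ᴿ b *ᴿ (a *ᴿ v +ᴿ b *ᴿ u)
    norm-reᴿ a b u v = ≗⇒≈ᴿ λ n → norm-re (seq a n) (seq b n) (seq u n) (seq v n)

    norm-imᴿ : ∀ a b u v → (a *ᴿ a +ᴿ b *ᴿ b) *ᴿ v ≈ᴿ
               a *ᴿ (a *ᴿ v +ᴿ b *ᴿ u) +ᴿ b *ᴿ -ᴿ (a *ᴿ u +ᴿ -ᴿ (b *ᴿ v))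
    norm-imᴿ a b u v = ≗⇒≈ᴿ λ n → norm-im (seq a n) (seq b n) (seq u n) (seq v n)

    c²≤norm : ∀ {c} a b → 0ℚ ℚ.< c → Eventually (λ n → c ℚ.≤ seq a n) →
              Eventually λ n → c ℚ.* c ℚ.≤ seq (a *ᴿ a +ᴿ b *ᴿ b) n
    c²≤norm {c} a b 0<c = eventually-map
      λ n c≤aₙ → let aₙ = seq a n ; bₙ = seq b n in
        ℚ.≤-trans (ℚ.*-monoˡ-≤-nonNeg c {{ℚ.nonNegative (ℚ.<⇒≤ 0<c)}} c≤aₙ)
        (ℚ.≤-trans (ℚ.*-monoʳ-≤-nonNeg aₙ {{ℚ.nonNegative (ℚ.≤-trans (ℚ.<⇒≤ 0<c) c≤aₙ)}} c≤aₙ)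
        (≡.subst (ℚ._≤ aₙ ℚ.* aₙ ℚ.+ bₙ ℚ.* bₙ) (ℚ.+-identityʳ (aₙ ℚ.* aₙ))
          (ℚ.+-monoʳ-≤ (aₙ ℚ.* aₙ) (0≤p² bₙ))))

opaque
  unfolding _+ℂ_

  *ℂ-cancel : ∀ {c} z w → 0ℚ ℚ.< c → Eventually (λ n → c ℚ.≤ seq (re z) n) →
              z *ℂ w ≈ℂ 0ℂ → w ≈ℂ 0ℂ
  *ℂ-cancel {c} (a +i b) (u +i v) 0<c c≤a (mk≈ℂ re≈0 im≈0) = mk≈ℂ
    (*ᴿ-cancel 0<c² (c²≤norm a b 0<c c≤a) (ℝR.trans (norm-reᴿ a b u v) (combine re≈0 im≈0)))
    (*ᴿ-cancel 0<c² (c²≤norm a b 0<c c≤a) (ℝR.trans (norm-imᴿ a b u v)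
      (combine im≈0 (ℝR.trans (ℝR.-‿cong re≈0) -0#≈0#))))
    where
    open RingProperties ℝR.ring using (-0#≈0#)
    combine : ∀ {x y} → x ≈ᴿ fromℚ 0ℚ → y ≈ᴿ fromℚ 0ℚ → a *ᴿ x +ᴿ b *ᴿ y ≈ᴿ fromℚ 0ℚ
    combine {x} {y} x≈0 y≈0 = begin
      a *ᴿ x +ᴿ b *ᴿ y                    ≈⟨ ℝR.+-cong (ℝR.*-congˡ x≈0) (ℝR.*-congˡ y≈0) ⟩
      a *ᴿ fromℚ 0ℚ +ᴿ b *ᴿ fromℚ 0ℚ      ≈⟨ ℝR.+-cong (ℝR.zeroʳ a) (ℝR.zeroʳ b) ⟩
      fromℚ 0ℚ +ᴿ fromℚ 0ℚ                ≈⟨ ℝR.+-identityʳ (fromℚ 0ℚ) ⟩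
      fromℚ 0ℚ                            ∎
      where open SetoidReasoning ℝR.setoid
    0<c² : 0ℚ ℚ.< c ℚ.* c
    0<c² = ℚ.positive⁻¹ (c ℚ.* c) {{ℚ.pos*pos⇒pos c {{ℚ.positive 0<c}} c {{ℚ.positive 0<c}}}}

module ℂR = CommutativeRing ℂ-commutativeRing

open CommutativeMonoidSum ℂR.+-commutativeMonoid using (sum; sum-cong-≋; sum-permute)

fromℕ : ℕ → ℂ
fromℕ n = n ×ℂ 1ℂ
  where open MonoidMult ℂR.+-monoid using () renaming (_×_ to _×ℂ_)

private
  ¼ ¾ ⅛ : ℚ
  ¼ = ½ ℚ.* ½
  ¾ = ½ ℚ.+ ¼
  ⅛ = ½ ℚ.* ¼

  +-cancelʳ-≤ : ∀ {p r} q → p ℚ.+ q ℚ.≤ r ℚ.+ q → p ℚ.≤ r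
  +-cancelʳ-≤ {p} {r} q h =
    ≡.subst₂ ℚ._≤_ (p+q-q≡p p q) (p+q-q≡p r q) (ℚ.+-monoˡ-≤ (ℚ.- q) h)
    where
    p+q-q≡p : ∀ p q → p ℚ.+ q ℚ.- q ≡ p
    p+q-q≡p = solve 2 (λ p q → p :+ q :- q := p) ≡.refl
      where open +-*-Solver

  separate : ∀ {p q r} → 0ℚ ℚ.< p → p ℚ.+ p ℚ.≤ q → q ℚ.+ p ℚ.≤ r → ∀ x →
             Eventually (λ n → p ℚ.≤ seq x n) ⊎ Eventually (λ n → seq x n ℚ.≤ r)
  separate {p} {q} 0<p 2p≤q q+p≤r x with cauchy x p 0<p
  ... | N , h with ℚ.≤-total q (seq x N)
  ... | inj₁ q≤x = inj₁ (N , λ n N≤n → +-cancelʳ-≤ p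
    (ℚ.≤-trans 2p≤q (ℚ.≤-trans q≤x (∣p-q∣≤⇒p≤q+ (h N n ℕ.≤-refl N≤n)))))
  ... | inj₂ x≤q = inj₂ (N , λ n N≤n →
    ℚ.≤-trans (∣p-q∣≤⇒p≤q+ (h n N N≤n ℕ.≤-refl)) (ℚ.≤-trans (ℚ.+-monoˡ-≤ p x≤q) q+p≤r))

opaque
  unfolding _+ᴿ_ _+ℂ_

  private
    re-0ℂ : ∀ k → seq (re 0ℂ) k ≡ 0ℚ
    re-0ℂ _ = ≡.refl

    re-1ℂ : ∀ k → seq (re 1ℂ) k ≡ 1ℚ
    re-1ℂ _ = ≡.refl

    re-+ : ∀ z w k → seq (re (z +ℂ w)) k ≡ seq (re z) k ℚ.+ seq (re w) k
    re-+ _ _ _ = ≡.refl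

private
  sum-re≥0 : ∀ {n} (f : Fin n → ℂ) k → (∀ i → 0ℚ ℚ.≤ seq (re (f i)) k) →
             0ℚ ℚ.≤ seq (re (sum f)) k
  sum-re≥0 {ℕ.zero}  f k f≥0 = ℚ.≤-reflexive (≡.sym (re-0ℂ k))
  sum-re≥0 {ℕ.suc n} f k f≥0 =
    ≡.subst₂ ℚ._≤_ (ℚ.+-identityʳ 0ℚ) (≡.sym (re-+ (f Fin.zero) _ k))
      (ℚ.+-mono-≤ (f≥0 Fin.zero) (sum-re≥0 (f ∘ Fin.suc) k (f≥0 ∘ Fin.suc)))

  sum-re≥ : ∀ {n p} (f : Fin n → ℂ) k → (∀ i → 0ℚ ℚ.≤ seq (re (f i)) k) →
            ∀ i → p ℚ.≤ seq (re (f i)) k → p ℚ.≤ seq (re (sum f)) k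
  sum-re≥ {ℕ.suc n} {p} f k f≥0 Fin.zero p≤f =
    ≡.subst₂ ℚ._≤_ (ℚ.+-identityʳ p) (≡.sym (re-+ (f Fin.zero) _ k))
      (ℚ.+-mono-≤ p≤f (sum-re≥0 (f ∘ Fin.suc) k (f≥0 ∘ Fin.suc)))
  sum-re≥ {ℕ.suc n} {p} f k f≥0 (Fin.suc i) p≤f =
    ≡.subst₂ ℚ._≤_ (ℚ.+-identityˡ p) (≡.sym (re-+ (f Fin.zero) _ k))
      (ℚ.+-mono-≤ (f≥0 Fin.zero) (sum-re≥ (f ∘ Fin.suc) k (f≥0 ∘ Fin.suc) i p≤f))

IsPrimePower : ℕ → Set
IsPrimePower q = ∃₂ λ p k → Prime p × q ≡ p ℕ.^ ℕ.suc k

record FiniteField (q : ℕ) (c ℓ : Level) : Set (suc (c ⊔ ℓ)) where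
  field
    commutativeRing : CommutativeRing c ℓ

  open CommutativeRing commutativeRing public

  field
    1≉0         : ¬ (1# ≈ 0#)
    invertible  : ∀ x → ¬ (x ≈ 0#) → ∃ λ y → x * y ≈ 1#
    enumeration : Inverse (≡.setoid (Fin q)) setoid

module Characters {q c ℓ} (F : FiniteField q c ℓ) where
  open FiniteField F
  open Inverse enumeration using (to; from; from-cong; strictlyInverseˡ; strictlyInverseʳ)

  infix 4 _≟_

  _≟_ : ∀ x y → Dec (x ≈ y)
  x ≟ y = map′
    (λ eq → trans (sym (strictlyInverseˡ x)) (trans (reflexive (≡.cong to eq)) (strictlyInverseˡ y)))
    from-cong
    (from x Fin.≟ from y)

  infix  9 _⁻¹
  infixl 7 _/_

  _⁻¹ : Carrier → Carrier
  x ⁻¹ with x ≟ 0#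
  ... | yes _   = 0#
  ... | no  x≉0 = proj₁ (invertible x x≉0)

  _/_ : Carrier → Carrier → Carrier
  x / y = x * y ⁻¹

  ⁻¹-zero : ∀ {x} → x ≈ 0# → x ⁻¹ ≈ 0#
  ⁻¹-zero {x} x≈0 with x ≟ 0#
  ... | yes _   = refl
  ... | no  x≉0 = ⊥-elim (x≉0 x≈0)

  ⁻¹-inverseʳ : ∀ {x} → ¬ (x ≈ 0#) → x * x ⁻¹ ≈ 1#
  ⁻¹-inverseʳ {x} x≉0 with x ≟ 0#
  ... | yes x≈0 = ⊥-elim (x≉0 x≈0)
  ... | no  x≉0 = proj₂ (invertible x x≉0)

  *-cancelˡ : ∀ {x y z} → ¬ (x ≈ 0#) → x * y ≈ x * z → y ≈ z
  *-cancelˡ {x} {y} {z} x≉0 xy≈xz = begin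
    y                  ≈⟨ undo y ⟨
    x ⁻¹ * (x * y)     ≈⟨ *-congˡ xy≈xz ⟩
    x ⁻¹ * (x * z)     ≈⟨ undo z ⟩
    z                  ∎
    where
    open SetoidReasoning setoid
    undo : ∀ w → x ⁻¹ * (x * w) ≈ w
    undo w = begin
      x ⁻¹ * (x * w)     ≈⟨ *-assoc (x ⁻¹) x w ⟨
      x ⁻¹ * x * w       ≈⟨ *-congʳ (trans (*-comm (x ⁻¹) x) (⁻¹-inverseʳ x≉0)) ⟩
      1# * w             ≈⟨ *-identityˡ w ⟩
      w                  ∎

  *-nonzero : ∀ {x y} → ¬ (x ≈ 0#) → ¬ (y ≈ 0#) → ¬ (x * y ≈ 0#)
  *-nonzero {x} x≉0 y≉0 xy≈0 = y≉0 (*-cancelˡ x≉0 (trans xy≈0 (sym (zeroʳ x))))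

  ⁻¹-unique : ∀ {x y} → x * y ≈ 1# → y ≈ x ⁻¹
  ⁻¹-unique {x} {y} xy≈1 = *-cancelˡ x≉0 (trans xy≈1 (sym (⁻¹-inverseʳ x≉0)))
    where
    x≉0 : ¬ (x ≈ 0#)
    x≉0 x≈0 = 1≉0 (trans (sym xy≈1) (trans (*-congʳ x≈0) (zeroˡ y)))

  ⁻¹-cong : ∀ {x y} → x ≈ y → x ⁻¹ ≈ y ⁻¹
  ⁻¹-cong {x} {y} x≈y with x ≟ 0#
  ... | yes x≈0 = sym (⁻¹-zero (trans (sym x≈y) x≈0))
  ... | no  x≉0 = ⁻¹-unique (trans (*-congʳ (sym x≈y)) (proj₂ (invertible x x≉0)))

  ⁻¹-distrib-* : ∀ x y → (x * y) ⁻¹ ≈ x ⁻¹ * y ⁻¹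
  ⁻¹-distrib-* x y = by-cases (x ≟ 0#) (y ≟ 0#)
    where
    open CommutativeSemigroupProperties *-commutativeSemigroup using (interchange)
    by-cases : Dec (x ≈ 0#) → Dec (y ≈ 0#) → (x * y) ⁻¹ ≈ x ⁻¹ * y ⁻¹
    by-cases (yes x≈0) _ = trans (⁻¹-zero (trans (*-congʳ x≈0) (zeroˡ y)))
      (sym (trans (*-congʳ (⁻¹-zero x≈0)) (zeroˡ (y ⁻¹))))
    by-cases (no _) (yes y≈0) = trans (⁻¹-zero (trans (*-congˡ y≈0) (zeroʳ x)))
      (sym (trans (*-congˡ (⁻¹-zero y≈0)) (zeroʳ (x ⁻¹))))
    by-cases (no x≉0) (no y≉0) = sym (⁻¹-unique (trans (interchange x y (x ⁻¹) (y ⁻¹))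
      (trans (*-cong (⁻¹-inverseʳ x≉0) (⁻¹-inverseʳ y≉0)) (*-identityˡ 1#))))

  -- A homomorphism from the multiplicative group of F to that of ℂ, stored as its extension
  -- by zero to F.  The values at x ≉ 0# are units, since χ(x) χ(x⁻¹) = χ(1) = 1.
  record Character : Set (c ⊔ ℓ) where
    infix 9 _⟨_⟩
    field
      _⟨_⟩ : Carrier → ℂ
      cong : ∀ {x y} → x ≈ y → _⟨_⟩ x ≈ℂ _⟨_⟩ y
      at-0 : _⟨_⟩ 0# ≈ℂ 0ℂ
      at-1 : _⟨_⟩ 1# ≈ℂ 1ℂ
      homo : ∀ x y → _⟨_⟩ (x * y) ≈ℂ _⟨_⟩ x *ℂ _⟨_⟩ y

  open Character public

  infix  4 _≋_
  infixl 7 _·_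

  _≋_ : Character → Character → Set c
  χ ≋ ψ = ∀ x → χ ⟨ x ⟩ ≈ℂ ψ ⟨ x ⟩

  vanish : ∀ χ {x} → x ≈ 0# → χ ⟨ x ⟩ ≈ℂ 0ℂ
  vanish χ x≈0 = ℂR.trans (cong χ x≈0) (at-0 χ)

  _·_ : Character → Character → Character
  χ · ψ = record
    { _⟨_⟩ = λ x → χ ⟨ x ⟩ *ℂ ψ ⟨ x ⟩
    ; cong = λ x≈y → ℂR.*-cong (cong χ x≈y) (cong ψ x≈y)
    ; at-0 = ℂR.trans (ℂR.*-congʳ (at-0 χ)) (ℂR.zeroˡ (ψ ⟨ 0# ⟩))
    ; at-1 = ℂR.trans (ℂR.*-cong (at-1 χ) (at-1 ψ)) (ℂR.*-identityˡ 1ℂ)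
    ; homo = λ x y → ℂR.trans (ℂR.*-cong (homo χ x y) (homo ψ x y))
        (interchange (χ ⟨ x ⟩) (χ ⟨ y ⟩) (ψ ⟨ x ⟩) (ψ ⟨ y ⟩))
    }
    where open CommutativeSemigroupProperties ℂR.*-commutativeSemigroup using (interchange)

  private
    nonzero : ∀ {x} → Dec (x ≈ 0#) → ℂ
    nonzero (yes _) = 0ℂ
    nonzero (no  _) = 1ℂ

    nonzero-yes : ∀ {x} (d : Dec (x ≈ 0#)) → x ≈ 0# → nonzero d ≡ 0ℂ
    nonzero-yes (yes _)   _   = ≡.refl
    nonzero-yes (no  x≉0) x≈0 = ⊥-elim (x≉0 x≈0)

    nonzero-no : ∀ {x} (d : Dec (x ≈ 0#)) → ¬ (x ≈ 0#) → nonzero d ≡ 1ℂ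
    nonzero-no (yes x≈0) x≉0 = ⊥-elim (x≉0 x≈0)
    nonzero-no (no  _)   _   = ≡.refl

  ε : Character
  ε = record
    { _⟨_⟩ = λ x → nonzero (x ≟ 0#)
    ; cong = λ {x} {y} x≈y → ℂR.reflexive (cong′ x≈y (x ≟ 0#) (y ≟ 0#))
    ; at-0 = ℂR.reflexive (nonzero-yes (0# ≟ 0#) refl)
    ; at-1 = ℂR.reflexive (nonzero-no (1# ≟ 0#) 1≉0)
    ; homo = λ x y → homo′ x y (x ≟ 0#) (y ≟ 0#)
    }
    where
    cong′ : ∀ {x y} → x ≈ y → (d : Dec (x ≈ 0#)) (e : Dec (y ≈ 0#)) → nonzero d ≡ nonzero e
    cong′ x≈y (yes x≈0) e = ≡.sym (nonzero-yes e (trans (sym x≈y) x≈0))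
    cong′ x≈y (no  x≉0) e = ≡.sym (nonzero-no e (λ y≈0 → x≉0 (trans x≈y y≈0)))

    homo′ : ∀ x y (d : Dec (x ≈ 0#)) (e : Dec (y ≈ 0#)) →
            nonzero (x * y ≟ 0#) ≈ℂ nonzero d *ℂ nonzero e
    homo′ x y (yes x≈0) e = ℂR.trans
      (ℂR.reflexive (nonzero-yes (x * y ≟ 0#) (trans (*-congʳ x≈0) (zeroˡ y))))
      (ℂR.sym (ℂR.zeroˡ (nonzero e)))
    homo′ x y (no x≉0) (yes y≈0) = ℂR.trans
      (ℂR.reflexive (nonzero-yes (x * y ≟ 0#) (trans (*-congˡ y≈0) (zeroʳ x))))
      (ℂR.sym (ℂR.zeroʳ 1ℂ))
    homo′ x y (no x≉0) (no y≉0) = ℂR.trans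
      (ℂR.reflexive (nonzero-no (x * y ≟ 0#) (*-nonzero x≉0 y≉0)))
      (ℂR.sym (ℂR.*-identityˡ 1ℂ))

  ε-nonzero : ∀ {x} → ¬ (x ≈ 0#) → ε ⟨ x ⟩ ≡ 1ℂ
  ε-nonzero {x} = nonzero-no (x ≟ 0#)

  bar : Character → Character
  bar χ = record
    { _⟨_⟩ = λ x → χ ⟨ x ⁻¹ ⟩
    ; cong = λ x≈y → cong χ (⁻¹-cong x≈y)
    ; at-0 = vanish χ (⁻¹-zero refl)
    ; at-1 = ℂR.trans (cong χ (sym (⁻¹-unique (*-identityˡ 1#)))) (at-1 χ)
    ; homo = λ x y → ℂR.trans (cong χ (⁻¹-distrib-* x y)) (homo χ (x ⁻¹) (y ⁻¹))
    }

  private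
    ·-identityˡ : ∀ χ → ε · χ ≋ χ
    ·-identityˡ χ x with x ≟ 0#
    ... | yes x≈0 = ℂR.trans (ℂR.zeroˡ (χ ⟨ x ⟩)) (ℂR.sym (vanish χ x≈0))
    ... | no  _   = ℂR.*-identityˡ (χ ⟨ x ⟩)

    ·-inverseʳ : ∀ χ → χ · bar χ ≋ ε
    ·-inverseʳ χ x = by-cases (x ≟ 0#)
      where
      by-cases : Dec (x ≈ 0#) → χ ⟨ x ⟩ *ℂ χ ⟨ x ⁻¹ ⟩ ≈ℂ ε ⟨ x ⟩
      by-cases (yes x≈0) = ℂR.trans (ℂR.*-congʳ (vanish χ x≈0))
        (ℂR.trans (ℂR.zeroˡ (χ ⟨ x ⁻¹ ⟩)) (ℂR.sym (vanish ε x≈0)))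
      by-cases (no x≉0) = ℂR.trans (ℂR.sym (homo χ x (x ⁻¹)))
        (ℂR.trans (cong χ (⁻¹-inverseʳ x≉0))
          (ℂR.trans (at-1 χ) (ℂR.reflexive (≡.sym (ε-nonzero x≉0)))))

    ·-comm : ∀ χ ψ → χ · ψ ≋ ψ · χ
    ·-comm χ ψ x = ℂR.*-comm (χ ⟨ x ⟩) (ψ ⟨ x ⟩)

  characterGroup : AbelianGroup (c ⊔ ℓ) c
  characterGroup = record
    { Carrier = Character ; _≈_ = _≋_ ; _∙_ = _·_ ; ε = ε ; _⁻¹ = bar
    ; isAbelianGroup = record
      { isGroup = record
        { isMonoid = record
          { isSemigroup = record
            { isMagma = record
              { isEquivalence = record
                { refl  = λ _ → ℂR.refl
                ; sym   = λ p x → ℂR.sym (p x)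
                ; trans = λ p q x → ℂR.trans (p x) (q x)
                }
              ; ∙-cong = λ p q x → ℂR.*-cong (p x) (q x)
              }
            ; assoc = λ χ ψ φ x → ℂR.*-assoc (χ ⟨ x ⟩) (ψ ⟨ x ⟩) (φ ⟨ x ⟩)
            }
          ; identity = ·-identityˡ , λ χ x → ℂR.trans (·-comm χ ε x) (·-identityˡ χ x)
          }
        ; inverse = (λ χ x → ℂR.trans (·-comm (bar χ) χ x) (·-inverseʳ χ x)) , ·-inverseʳ
        ; ⁻¹-cong = λ p x → p (x ⁻¹)
        }
      ; comm = ·-comm
      }
    }

  ∑ : (Carrier → ℂ) → ℂ
  ∑ f = sum (λ i → f (to i))

  infix 5 ∑
  syntax ∑ (λ u → e) = ∑[ u ] e

  ∑-shift : ∀ χ {g} → ¬ (g ≈ 0#) → χ ⟨ g ⟩ *ℂ ∑ (χ ⟨_⟩) ≈ℂ ∑ (χ ⟨_⟩)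
  ∑-shift χ {g} g≉0 = begin
    χ ⟨ g ⟩ *ℂ ∑ (χ ⟨_⟩)                  ≈⟨ *-distribˡ-sum (χ ⟨ g ⟩) (λ i → χ ⟨ to i ⟩) ⟩
    sum (λ i → χ ⟨ g ⟩ *ℂ χ ⟨ to i ⟩)     ≈⟨ sum-cong-≋ (λ i → ℂR.sym (homo χ g (to i))) ⟩
    sum (λ i → χ ⟨ g * to i ⟩)            ≈⟨ sum-cong-≋ (λ i → cong χ (sym (strictlyInverseˡ (g * to i)))) ⟩
    sum (λ i → χ ⟨ to (π ⟨$⟩ʳ i) ⟩)       ≈⟨ sum-permute (λ i → χ ⟨ to i ⟩) π ⟨
    ∑ (χ ⟨_⟩)                             ∎
    where
    open SetoidReasoning ℂR.setoid
    open SemiringSum ℂR.semiring using (*-distribˡ-sum)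
    multiply : ∀ h k → h * k ≈ 1# → ∀ i → from (h * to (from (k * to i))) ≡ i
    multiply h k hk≈1 i = ≡.trans (from-cong (trans (*-congˡ (strictlyInverseˡ (k * to i)))
      (trans (sym (*-assoc h k (to i))) (trans (*-congʳ hk≈1) (*-identityˡ (to i))))))
      (strictlyInverseʳ i)
    π : Permutation′ q
    π = permutation (λ i → from (g * to i)) (λ i → from (g ⁻¹ * to i))
      (multiply g (g ⁻¹) (⁻¹-inverseʳ g≉0))
      (multiply (g ⁻¹) g (trans (*-comm (g ⁻¹) g) (⁻¹-inverseʳ g≉0)))

  -- Equality in ℂ is not constructively decidable, but triviality of χ can be read off from any sufficiently
  -- close rational approximation of Re ∑ χ, which is either 0 or q - 1.
  trivial? : ∀ χ → Dec (χ ≋ ε)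
  trivial? χ with separate (from-yes (0ℚ ℚ.<? ¼)) (from-yes (¼ ℚ.+ ¼ ℚ.≤? ½))
                    (from-yes (½ ℚ.+ ¼ ℚ.≤? ¾)) (re (∑ (χ ⟨_⟩)))
  ... | inj₁ S≥¼ = yes λ x → by-cases x (x ≟ 0#)
    where
    open SetoidReasoning ℂR.setoid
    S : ℂ
    S = ∑ (χ ⟨_⟩)
    S*[χ-1]≈0 : ∀ {x} → ¬ (x ≈ 0#) → S *ℂ (χ ⟨ x ⟩ -ℂ 1ℂ) ≈ℂ 0ℂ
    S*[χ-1]≈0 {x} x≉0 = begin
      S *ℂ (χ ⟨ x ⟩ +ℂ -ℂ 1ℂ)             ≈⟨ ℂR.distribˡ S (χ ⟨ x ⟩) (-ℂ 1ℂ) ⟩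
      S *ℂ χ ⟨ x ⟩ +ℂ S *ℂ -ℂ 1ℂ          ≈⟨ ℂR.+-cong (ℂR.trans (ℂR.*-comm S (χ ⟨ x ⟩)) (∑-shift χ x≉0))
                                                       (ℂR.sym (-‿distribʳ-* S 1ℂ)) ⟩
      S +ℂ -ℂ (S *ℂ 1ℂ)                   ≈⟨ ℂR.+-congˡ (ℂR.-‿cong (ℂR.*-identityʳ S)) ⟩
      S +ℂ -ℂ S                           ≈⟨ ℂR.-‿inverseʳ S ⟩
      0ℂ                                  ∎
      where open RingProperties ℂR.ring using (-‿distribʳ-*)
    by-cases : ∀ x → Dec (x ≈ 0#) → χ ⟨ x ⟩ ≈ℂ ε ⟨ x ⟩
    by-cases x (yes x≈0) = ℂR.trans (vanish χ x≈0) (ℂR.sym (vanish ε x≈0))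
    by-cases x (no  x≉0) = ℂR.trans
      (x∙y⁻¹≈ε⇒x≈y (χ ⟨ x ⟩) 1ℂ
        (*ℂ-cancel S (χ ⟨ x ⟩ -ℂ 1ℂ) (from-yes (0ℚ ℚ.<? ¼)) S≥¼ (S*[χ-1]≈0 x≉0)))
      (ℂR.reflexive (≡.sym (ε-nonzero x≉0)))
      where open GroupProperties ℂR.+-group using (x∙y⁻¹≈ε⇒x≈y)
  ... | inj₂ S≤¾ = no λ χ≋ε → absurd (eventually-× S≤¾
      (close (re≈ (sum-cong-≋ (λ i → ℂR.sym (χ≋ε (to i))))) ⅛ (from-yes (0ℚ ℚ.<? ⅛))))
    where
    ε≥0 : ∀ k x → 0ℚ ℚ.≤ seq (re (ε ⟨ x ⟩)) k
    ε≥0 k x with x ≟ 0#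
    ... | yes _ = ℚ.≤-reflexive (≡.sym (re-0ℂ k))
    ... | no  _ = ≡.subst (0ℚ ℚ.≤_) (≡.sym (re-1ℂ k)) (from-yes (0ℚ ℚ.≤? 1ℚ))
    ε-one : ∀ k → 1ℚ ℚ.≤ seq (re (ε ⟨ to (from 1#) ⟩)) k
    ε-one k = ℚ.≤-reflexive (≡.sym (≡.trans
      (≡.cong (λ z → seq (re z) k)
        (ε-nonzero (λ h → 1≉0 (trans (sym (strictlyInverseˡ 1#)) h))))
      (re-1ℂ k)))
    absurd : ¬ Eventually λ k → seq (re (∑ (χ ⟨_⟩))) k ℚ.≤ ¾ ×
               ℚ.∣ seq (re (∑ (ε ⟨_⟩))) k ℚ.- seq (re (∑ (χ ⟨_⟩))) k ∣ ℚ.≤ ⅛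
    absurd (N , h) with h N ℕ.≤-refl
    ... | S≤¾ , near = from-no (1ℚ ℚ.≤? ¾ ℚ.+ ⅛)
      (ℚ.≤-trans (sum-re≥ (λ i → ε ⟨ to i ⟩) N (λ i → ε≥0 N (to i)) (from 1#) (ε-one N))
        (ℚ.≤-trans (∣p-q∣≤⇒p≤q+ near) (ℚ.+-monoˡ-≤ ⅛ S≤¾)))

  δ : Character → ℂ
  δ χ with trivial? χ
  ... | yes _ = 1ℂ
  ... | no  _ = 0ℂ

  J : Character → Character → ℂ
  J χ ψ = ∑[ u ] χ ⟨ u ⟩ *ℂ ψ ⟨ 1# - u ⟩

  binom : Character → Character → ℂ
  binom A B = B ⟨ - 1# ⟩ *ℂ J A (bar B)

  ₂F₁ : (A B C : Character) (x : Carrier) → ℂ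
  ₂F₁ A B C x =
    ε ⟨ x ⟩ *ℂ (B · C) ⟨ - 1# ⟩ *ℂ
    (∑[ u ] B ⟨ u ⟩ *ℂ (bar B · C) ⟨ 1# - u ⟩ *ℂ bar A ⟨ 1# - x * u ⟩)

  F₂ : (A B B′ C C′ : Character) (x y : Carrier) → ℂ
  F₂ A B B′ C C′ x y =
    ε ⟨ x * y ⟩ *ℂ (B · B′ · C · C′) ⟨ - 1# ⟩ *ℂ
    (∑[ u ] ∑[ v ] B ⟨ u ⟩ *ℂ B′ ⟨ v ⟩ *ℂ (bar B · C) ⟨ 1# - u ⟩ *ℂ (bar B′ · C′) ⟨ 1# - v ⟩
                   *ℂ bar A ⟨ 1# - u * x - v * y ⟩)

{-# OPTIONS --safe #-}
-- With C = B the factor B̄C(1 - u) is just the condition u ≠ 1, so F₂ is the sum over all u minus its term at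
-- u = 1, which is the first ₂F₁.  In the full sum over u the inner sum H(t) = ∑ᵤ B(u) Ā(t - u x), taken at t = 1 - v y,
-- equals B̄(x) J(B, Ā) (ĀB)(t) for t ≠ 0, which produces the second ₂F₁; the only other value, t = 0 at v = 1/y,
-- is Ā(-x) ∑ᵤ (BĀ)(u), the term with (q - 1) δ(AB̄).
module Submission where

import Algebra.Properties.CommutativeSemigroup as CommutativeSemigroupProperties
import Algebra.Properties.Group as GroupProperties
import Algebra.Properties.Ring as RingProperties
import Algebra.Properties.Semiring.Sum as SemiringSum
import Algebra.Solver.CommutativeMonoid as CommutativeMonoidSolver
open import Data.Empty using (⊥-elim)
open import Data.Fin.Base using (Fin; punchIn)
open import Data.Fin.Properties using (punchInᵢ≢i)
open import Data.Nat.Base as ℕ using (ℕ; z≤n; s≤s)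
import Data.Nat.Properties as ℕ
open import Data.Product.Base using (_,_)
open import Data.Rational.Base as ℚ using (ℚ; 0ℚ; 1ℚ; ½)
import Data.Rational.Properties as ℚ
open import Data.Sum.Base using (_⊎_; inj₁; inj₂)
open import Function.Bundles using (Inverse)
import Function.Construct.Composition as Composition
import Function.Construct.Symmetry as Symmetry
import Relation.Binary.PropositionalEquality as ≡
open ≡ using (_≡_; _≢_)
import Relation.Binary.Reasoning.Setoid as SetoidReasoning
open import Relation.Nullary.Decidable using (Dec; yes; no; from-yes)
open import Relation.Nullary.Negation using (¬_)
open import Defs

open import Algebra.Solver.Ring.NaturalCoefficients.Default ℂR.commutativeSemiring
  using (solve; _:=_; _:+_; _:*_)
open SemiringSum ℂR.semiring
  using (sum; sum-cong-≋; sum-remove; sum-permute; sum-replicate; ∑-comm; *-distribˡ-sum)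
open CommutativeMonoidSolver ℂR.*-commutativeMonoid
  using (_⊕_; _⊜_; id) renaming (solve to solve*)
open RingProperties ℂR.ring
  using (x∙y⁻¹≈ε⇒x≈y; x≈y⇒x∙y⁻¹≈ε; \\-leftDividesʳ; -‿distribʳ-*; -0#≈0#)

-- Sums with one exceptional index, and identities in `ℂ`.

-- Removing index `i` leaves the same remainder on both sides. The vanishing `g i` is then added
-- back, so that the result is again a full sum.
sum-puncture : ∀ {n} {f g : Fin n → ℂ} i → (∀ j → j ≢ i → f j ≈ℂ g j) → g i ≈ℂ 0ℂ →
               sum f ≈ℂ f i +ℂ sum g
sum-puncture {ℕ.suc n} {f} {g} i f≈g gᵢ≈0 = begin
  sum f                                ≈⟨ sum-remove {i = i} f ⟩
  f i +ℂ sum (λ j → f (punchIn i j))   ≈⟨ ℂR.+-congˡ (sum-cong-≋ λ j →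
                                            f≈g (punchIn i j) (punchInᵢ≢i i j)) ⟩
  f i +ℂ rest                          ≈⟨ ℂR.+-congˡ (ℂR.+-identityˡ rest) ⟨
  f i +ℂ (0ℂ +ℂ rest)                  ≈⟨ ℂR.+-congˡ (ℂR.+-congʳ gᵢ≈0) ⟨
  f i +ℂ (g i +ℂ rest)                 ≈⟨ ℂR.+-congˡ (sum-remove {i = i} g) ⟨
  f i +ℂ sum g                         ∎
  where
  open SetoidReasoning ℂR.setoid
  rest : ℂ
  rest = sum (λ j → g (punchIn i j))

0*≈0 : ∀ {z} w → z ≈ℂ 0ℂ → z *ℂ w ≈ℂ 0ℂ
0*≈0 w z≈0 = ℂR.trans (ℂR.*-congʳ z≈0) (ℂR.zeroˡ w)

*0≈0 : ∀ z {w} → w ≈ℂ 0ℂ → z *ℂ w ≈ℂ 0ℂ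
*0≈0 z w≈0 = ℂR.trans (ℂR.*-congˡ w≈0) (ℂR.zeroʳ z)

-0+0+0≈0 : ∀ {z w v} → z ≈ℂ 0ℂ → w ≈ℂ 0ℂ → v ≈ℂ 0ℂ → -ℂ z +ℂ w +ℂ v ≈ℂ 0ℂ
-0+0+0≈0 z≈0 w≈0 v≈0 = ℂR.trans
  (ℂR.+-cong (ℂR.trans (ℂR.+-cong (ℂR.trans (ℂR.-‿cong z≈0) -0#≈0#) w≈0) (ℂR.+-identityˡ 0ℂ)) v≈0)
  (ℂR.+-identityˡ 0ℂ)

-- Brings an equation into the shape that `*ℂ-cancel` accepts, a product equal to `0ℂ`.
*-difference : ∀ {z w v} → z *ℂ w ≈ℂ z *ℂ v → z *ℂ (w -ℂ v) ≈ℂ 0ℂ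
*-difference {z} {w} {v} zw≈zv = ℂR.trans (ℂR.distribˡ z w (-ℂ v))
  (ℂR.trans (ℂR.+-congˡ (ℂR.sym (-‿distribʳ-* z v))) (x≈y⇒x∙y⁻¹≈ε zw≈zv))

-- Approximate comparison of real parts.

¼ ¾ : ℚ
¼ = ½ ℚ.* ½
¾ = ½ ℚ.+ ¼

∣p-q∣≤r⇒p≤r+q : ∀ p q {r} → ℚ.∣ p ℚ.- q ∣ ℚ.≤ r → p ℚ.≤ r ℚ.+ q
∣p-q∣≤r⇒p≤r+q p q {r} h = begin
  p                        ≡⟨ //-rightDividesˡ q p ⟨
  (p ℚ.- q) ℚ.+ q          ≤⟨ ℚ.+-monoˡ-≤ q (ℚ.≤-trans (p≤∣p∣ (p ℚ.- q)) h) ⟩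
  r ℚ.+ q                  ∎
  where
  open ℚ.≤-Reasoning
  open GroupProperties ℚ.+-0-group using (//-rightDividesˡ)
  p≤∣p∣ : ∀ p → p ℚ.≤ ℚ.∣ p ∣
  p≤∣p∣ p with ℚ.≤-total 0ℚ p
  ... | inj₁ 0≤p = ℚ.≤-reflexive (≡.sym (ℚ.0≤p⇒∣p∣≡p 0≤p))
  ... | inj₂ p≤0 = ℚ.≤-trans p≤0 (ℚ.0≤∣p∣ p)

-- The two alternatives overlap, so one rational term decides: beyond `N` the sequence stays within
-- `¼` of `seq x N`, which is compared with `½`.
¼≤x∨x≤¾ : ∀ x → Eventually (λ n → ¼ ℚ.≤ seq x n) ⊎ Eventually (λ n → seq x n ℚ.≤ ¾)
¼≤x∨x≤¾ x with cauchy x ¼ (from-yes (0ℚ ℚ.<? ¼))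
... | N , h with ℚ.≤-total ½ (seq x N)
...   | inj₁ ½≤x = inj₁ (N , λ n N≤n → begin
    -- Closed rationals evaluate: `- ¼ + ½` is `¼`, and below `- ¼ + ¼` is `0ℚ`.
    ℚ.- ¼ ℚ.+ ½                  ≤⟨ ℚ.+-monoʳ-≤ (ℚ.- ¼) (ℚ.≤-trans ½≤x
                                      (∣p-q∣≤r⇒p≤r+q (seq x N) (seq x n) (h N n ℕ.≤-refl N≤n))) ⟩
    ℚ.- ¼ ℚ.+ (¼ ℚ.+ seq x n)    ≡⟨ ℚ.+-assoc (ℚ.- ¼) ¼ (seq x n) ⟨
    0ℚ ℚ.+ seq x n               ≡⟨ ℚ.+-identityˡ (seq x n) ⟩
    seq x n                      ∎)
  where open ℚ.≤-Reasoning
...   | inj₂ x≤½ = inj₂ (N , λ n N≤n → begin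
    seq x n                      ≤⟨ ∣p-q∣≤r⇒p≤r+q (seq x n) (seq x N) (h n N N≤n ℕ.≤-refl) ⟩
    ¼ ℚ.+ seq x N                ≤⟨ ℚ.+-monoʳ-≤ ¼ x≤½ ⟩
    ¾                            ∎)
  where open ℚ.≤-Reasoning

opaque
  unfolding _+ᴿ_ _+ℂ_

  0≤re-fromℕ : ∀ n k → 0ℚ ℚ.≤ seq (re (fromℕ n)) k
  0≤re-fromℕ ℕ.zero    k = ℚ.≤-refl
  0≤re-fromℕ (ℕ.suc n) k = ℚ.+-mono-≤ (from-yes (0ℚ ℚ.≤? 1ℚ)) (0≤re-fromℕ n k)

  -- Since n - 1 is at least 1, the bound is 1 - ¾. It makes q - 1 - S cancellable whenever Re S is
  -- too small for S itself to be cancelled.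
  ¼≤re[n-1-z] : ∀ {n} z k → 2 ℕ.≤ n → seq (re z) k ℚ.≤ ¾ →
                ¼ ℚ.≤ seq (re (fromℕ n -ℂ 1ℂ -ℂ z)) k
  ¼≤re[n-1-z] {ℕ.suc (ℕ.suc n)} z k (s≤s (s≤s z≤n)) z≤¾ = ℚ.+-mono-≤
    (ℚ.+-monoˡ-≤ (ℚ.- 1ℚ) (ℚ.+-monoʳ-≤ 1ℚ (ℚ.+-monoʳ-≤ 1ℚ (0≤re-fromℕ n k))))
    (ℚ.neg-antimono-≤ z≤¾)

i≢j⇒2≤n : ∀ {n} {i j : Fin n} → i ≢ j → 2 ℕ.≤ n
i≢j⇒2≤n {ℕ.suc ℕ.zero} {Fin.zero} {Fin.zero} i≢j = ⊥-elim (i≢j ≡.refl)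
i≢j⇒2≤n {ℕ.suc (ℕ.suc n)} _ = s≤s (s≤s z≤n)

module CharacterSums {q ℓ₁ ℓ₂} (F : FiniteField q ℓ₁ ℓ₂) where
  open FiniteField F
  open Characters F
  open Inverse enumeration using (to; from; from-cong; strictlyInverseˡ; strictlyInverseʳ)

  -- Sums over `F` and orthogonality of characters.

  ∑-cong : ∀ {f g} → (∀ x → f x ≈ℂ g x) → ∑ f ≈ℂ ∑ g
  ∑-cong f≈g = sum-cong-≋ (λ i → f≈g (to i))

  -- Conjugating `σ` by `enumeration` gives a permutation of the indices. Congruence of `f` is
  -- needed because `to (from (σ x))` agrees with `σ x` only up to `≈`.
  ∑-reindex : ∀ {f} → (∀ {x y} → x ≈ y → f x ≈ℂ f y) → (σ τ : Carrier → Carrier) →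
              (∀ {x y} → x ≈ y → σ x ≈ σ y) → (∀ {x y} → x ≈ y → τ x ≈ τ y) →
              (∀ x → σ (τ x) ≈ x) → (∀ x → τ (σ x) ≈ x) →
              ∑ f ≈ℂ ∑[ x ] f (σ x)
  ∑-reindex {f} f-cong σ τ σ-cong τ-cong στ τσ = ℂR.trans
    (sum-permute (λ i → f (to i))
      (Composition.inverse (Composition.inverse enumeration σ↔) (Symmetry.inverse enumeration)))
    (∑-cong (λ x → f-cong (strictlyInverseˡ (σ x))))
    where
    σ↔ : Inverse setoid setoid
    σ↔ = record
      { to = σ ; from = τ ; to-cong = σ-cong ; from-cong = τ-cong
      ; inverse = (λ {x} y≈τx → trans (σ-cong y≈τx) (στ x))
                , (λ {x} y≈σx → trans (τ-cong y≈σx) (τσ x))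
      }

  -- Serves three exceptional points: 0, where `ε` differs from the constant 1; u = 1, where
  -- `(bar B · B) ⟨ 1# - u ⟩` vanishes; and v = 1/y, where 1 - v y vanishes.
  ∑-puncture : ∀ {f g} → (∀ {x y} → x ≈ y → f x ≈ℂ f y) → (∀ {x y} → x ≈ y → g x ≈ℂ g y) →
               ∀ a → (∀ x → ¬ (x ≈ a) → f x ≈ℂ g x) → g a ≈ℂ 0ℂ → ∑ f ≈ℂ f a +ℂ ∑ g
  ∑-puncture {f} {g} f-cong g-cong a f≈g ga≈0 = ℂR.trans
    (sum-puncture (from a)
      (λ j j≢ → f≈g (to j) λ h → j≢ (≡.trans (≡.sym (strictlyInverseʳ j)) (from-cong h)))
      (ℂR.trans (g-cong (strictlyInverseˡ a)) ga≈0))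
    (ℂR.+-congʳ (f-cong (strictlyInverseˡ a)))

  ∑-swap : ∀ (f : Carrier → Carrier → ℂ) → (∑[ u ] ∑[ v ] f u v) ≈ℂ (∑[ v ] ∑[ u ] f u v)
  ∑-swap f = ∑-comm (λ i j → f (to i) (to j))

  ∑-*ˡ : ∀ z f → z *ℂ ∑ f ≈ℂ (∑[ u ] z *ℂ f u)
  ∑-*ˡ z f = *-distribˡ-sum z (λ i → f (to i))

  q≥2 : 2 ℕ.≤ q
  q≥2 = i≢j⇒2≤n {i = from 1#} {j = from 0#} λ h →
    1≉0 (trans (sym (strictlyInverseˡ 1#)) (trans (reflexive (≡.cong to h)) (strictlyInverseˡ 0#)))

  ε-one : ∀ {x} → ¬ (x ≈ 0#) → ε ⟨ x ⟩ ≈ℂ 1ℂ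
  ε-one x≉0 = ℂR.reflexive (ε-nonzero x≉0)

  ∑ε≈q-1 : ∑ (ε ⟨_⟩) ≈ℂ fromℕ q -ℂ 1ℂ
  ∑ε≈q-1 = begin
    S                        ≈⟨ ℂR.+-identityˡ S ⟨
    0ℂ +ℂ S                  ≈⟨ ℂR.+-congʳ (ℂR.-‿inverseˡ 1ℂ) ⟨
    -ℂ 1ℂ +ℂ 1ℂ +ℂ S         ≈⟨ ℂR.+-assoc (-ℂ 1ℂ) 1ℂ S ⟩
    -ℂ 1ℂ +ℂ (1ℂ +ℂ S)       ≈⟨ ℂR.+-comm (-ℂ 1ℂ) (1ℂ +ℂ S) ⟩
    1ℂ +ℂ S -ℂ 1ℂ            ≈⟨ ℂR.+-congʳ (∑-puncture (λ _ → ℂR.refl) (cong ε) 0#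
                                  (λ _ x≉0 → ℂR.sym (ε-one x≉0)) (at-0 ε)) ⟨
    (∑[ _ ] 1ℂ) -ℂ 1ℂ        ≈⟨ ℂR.+-congʳ (sum-replicate q) ⟩
    fromℕ q -ℂ 1ℂ            ∎
    where
    open SetoidReasoning ℂR.setoid
    S : ℂ
    S = ∑ (ε ⟨_⟩)

  -- For nonzero `x` this is invariance of the sum under multiplication by `x`. Writing `ε ⟨ x ⟩` in
  -- place of 1 extends it to `x` = 0, so that it can be summed over all of `F`.
  ∑-absorb : ∀ χ x → ∑ (χ ⟨_⟩) *ℂ χ ⟨ x ⟩ ≈ℂ ∑ (χ ⟨_⟩) *ℂ ε ⟨ x ⟩
  ∑-absorb χ x = by-cases (x ≟ 0#)
    where
    S : ℂ
    S = ∑ (χ ⟨_⟩)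
    by-cases : Dec (x ≈ 0#) → S *ℂ χ ⟨ x ⟩ ≈ℂ S *ℂ ε ⟨ x ⟩
    by-cases (yes x≈0) = ℂR.*-congˡ (ℂR.trans (vanish χ x≈0) (ℂR.sym (vanish ε x≈0)))
    by-cases (no  x≉0) = ℂR.trans (ℂR.*-comm S (χ ⟨ x ⟩)) (ℂR.trans (∑-shift χ x≉0)
      (ℂR.trans (ℂR.sym (ℂR.*-identityʳ S))
        (ℂR.*-congˡ (ℂR.sym (ε-one x≉0)))))

  -- The sum S of χ satisfies S χ(x) = S ε(x), hence also S² = (q - 1) S.  Equality in ℂ being undecidable,
  -- an approximation of Re S decides whether S or q - 1 - S can be cancelled.
  ∑-nontrivial : ∀ χ → ¬ (χ ≋ ε) → ∑ (χ ⟨_⟩) ≈ℂ 0ℂ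
  ∑-nontrivial χ χ≉ε with ¼≤x∨x≤¾ (re (∑ (χ ⟨_⟩)))
  ... | inj₁ ¼≤S = ⊥-elim (χ≉ε λ x → x∙y⁻¹≈ε⇒x≈y (χ ⟨ x ⟩) (ε ⟨ x ⟩)
    (*ℂ-cancel (∑ (χ ⟨_⟩)) (χ ⟨ x ⟩ -ℂ ε ⟨ x ⟩) (from-yes (0ℚ ℚ.<? ¼)) ¼≤S
      (*-difference (∑-absorb χ x))))
  ... | inj₂ (N , S≤¾) = *ℂ-cancel (fromℕ q -ℂ 1ℂ -ℂ S) S (from-yes (0ℚ ℚ.<? ¼))
    (N , λ k N≤k → ¼≤re[n-1-z] S k q≥2 (S≤¾ k N≤k))
    (ℂR.trans (ℂR.*-comm (fromℕ q -ℂ 1ℂ -ℂ S) S) (*-difference (ℂR.sym S²≈S[q-1])))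
    where
    open SetoidReasoning ℂR.setoid
    S : ℂ
    S = ∑ (χ ⟨_⟩)
    S²≈S[q-1] : S *ℂ S ≈ℂ S *ℂ (fromℕ q -ℂ 1ℂ)
    S²≈S[q-1] = begin
      S *ℂ S                      ≈⟨ ∑-*ˡ S (χ ⟨_⟩) ⟩
      (∑[ x ] S *ℂ χ ⟨ x ⟩)       ≈⟨ ∑-cong (∑-absorb χ) ⟩
      (∑[ x ] S *ℂ ε ⟨ x ⟩)       ≈⟨ ∑-*ˡ S (ε ⟨_⟩) ⟨
      S *ℂ ∑ (ε ⟨_⟩)              ≈⟨ ℂR.*-congˡ ∑ε≈q-1 ⟩
      S *ℂ (fromℕ q -ℂ 1ℂ)        ∎

  -- Arithmetic in `F` and values of characters.

  private
    module 𝔽 = RingProperties ring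
  open CommutativeSemigroupProperties *-commutativeSemigroup using (xy∙z≈xz∙y)

  -1≉0 : ¬ (- 1# ≈ 0#)
  -1≉0 -1≈0 = 1≉0 (𝔽.-‿injective (trans -1≈0 (sym 𝔽.-0#≈0#)))

  1-x≉0 : ∀ {x} → ¬ (x ≈ 1#) → ¬ (1# - x ≈ 0#)
  1-x≉0 {x} x≉1 1-x≈0 = x≉1 (sym (𝔽.x∙y⁻¹≈ε⇒x≈y 1# x 1-x≈0))

  1-[1-x]≈x : ∀ x → 1# - (1# - x) ≈ x
  1-[1-x]≈x x = trans (+-congˡ (𝔽.⁻¹-anti-homo‿- 1# x))
    (trans (sym (+-assoc 1# x (- 1#))) (𝔽.xyx⁻¹≈y 1# x))

  x[1-y]≈x-xy : ∀ x y → x * (1# - y) ≈ x - x * y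
  x[1-y]≈x-xy x y = trans (𝔽.x[y-z]≈xy-xz x 1# y) (+-congʳ (*-identityʳ x))

  ⁻¹-nonzero : ∀ {x} → ¬ (x ≈ 0#) → ¬ (x ⁻¹ ≈ 0#)
  ⁻¹-nonzero {x} x≉0 x⁻¹≈0 =
    1≉0 (trans (sym (⁻¹-inverseʳ x≉0)) (trans (*-congˡ x⁻¹≈0) (zeroʳ x)))

  ⁻¹-involutive : ∀ x → x ⁻¹ ⁻¹ ≈ x
  ⁻¹-involutive x = by-cases (x ≟ 0#)
    where
    by-cases : Dec (x ≈ 0#) → x ⁻¹ ⁻¹ ≈ x
    by-cases (yes x≈0) = trans (⁻¹-zero (⁻¹-zero x≈0)) (sym x≈0)
    by-cases (no  x≉0) = sym (⁻¹-unique (trans (*-comm (x ⁻¹) x) (⁻¹-inverseʳ x≉0)))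

  x/y*y≈x : ∀ x {y} → ¬ (y ≈ 0#) → x / y * y ≈ x
  x/y*y≈x x {y} y≉0 = trans (*-assoc x (y ⁻¹) y)
    (trans (*-congˡ (trans (*-comm (y ⁻¹) y) (⁻¹-inverseʳ y≉0))) (*-identityʳ x))

  χ[x]χ[x⁻¹]≈1 : ∀ χ {x} → ¬ (x ≈ 0#) → χ ⟨ x ⟩ *ℂ χ ⟨ x ⁻¹ ⟩ ≈ℂ 1ℂ
  χ[x]χ[x⁻¹]≈1 χ {x} x≉0 =
    ℂR.trans (ℂR.sym (homo χ x (x ⁻¹))) (ℂR.trans (cong χ (⁻¹-inverseʳ x≉0)) (at-1 χ))

  χ[-1]²≈1 : ∀ χ → χ ⟨ - 1# ⟩ *ℂ χ ⟨ - 1# ⟩ ≈ℂ 1ℂ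
  χ[-1]²≈1 χ = ℂR.trans (ℂR.sym (homo χ (- 1#) (- 1#)))
    (ℂR.trans (cong χ (trans (𝔽.-1*x≈-x (- 1#)) (𝔽.-‿involutive 1#))) (at-1 χ))

  homo-neg : ∀ χ x → χ ⟨ - x ⟩ ≈ℂ χ ⟨ - 1# ⟩ *ℂ χ ⟨ x ⟩
  homo-neg χ x = ℂR.trans (cong χ (sym (𝔽.-1*x≈-x x))) (homo χ (- 1#) x)

  bar-bar : ∀ χ x → χ ⟨ x ⁻¹ ⁻¹ ⟩ ≈ℂ χ ⟨ x ⟩
  bar-bar χ x = cong χ (⁻¹-involutive x)

  -- Substitutions in character sums.

  ∑-scale : ∀ {f} → (∀ {x y} → x ≈ y → f x ≈ℂ f y) → ∀ {g} → ¬ (g ≈ 0#) →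
            ∑ f ≈ℂ (∑[ w ] f (g * w))
  ∑-scale f-cong {g} g≉0 = ∑-reindex f-cong (g *_) (g ⁻¹ *_) *-congˡ *-congˡ
    (undo (⁻¹-inverseʳ g≉0)) (undo (trans (*-comm (g ⁻¹) g) (⁻¹-inverseʳ g≉0)))
    where
    undo : ∀ {h k} → h * k ≈ 1# → ∀ w → h * (k * w) ≈ w
    undo {h} {k} hk≈1 w = trans (sym (*-assoc h k w)) (trans (*-congʳ hk≈1) (*-identityˡ w))

  -- Inversion is an involution of all of `F`, because the inverse of 0 is set to 0.
  ∑-bar : ∀ χ → ∑ (χ ⟨_⟩) ≈ℂ ∑ (bar χ ⟨_⟩)
  ∑-bar χ = ∑-reindex (cong χ) _⁻¹ _⁻¹ ⁻¹-cong ⁻¹-cong ⁻¹-involutive ⁻¹-involutive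

  -- The substitution u = (t / x) w turns t - u x into t (1 - w), so the values at `t` and `x` leave
  -- the sum and a Jacobi sum remains. It is a bijection because `t` and `x` are both nonzero.
  ∑-linear : ∀ χ ψ {x t} → ¬ (x ≈ 0#) → ¬ (t ≈ 0#) →
             (∑[ u ] χ ⟨ u ⟩ *ℂ ψ ⟨ t - u * x ⟩) ≈ℂ bar χ ⟨ x ⟩ *ℂ J χ ψ *ℂ (χ · ψ) ⟨ t ⟩
  ∑-linear χ ψ {x} {t} x≉0 t≉0 = begin
    (∑[ u ] χ ⟨ u ⟩ *ℂ ψ ⟨ t - u * x ⟩)
      ≈⟨ ∑-scale (λ u≈v → ℂR.*-cong (cong χ u≈v) (cong ψ (+-congˡ (-‿cong (*-congʳ u≈v)))))
           (*-nonzero t≉0 (⁻¹-nonzero x≉0)) ⟩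
    (∑[ w ] χ ⟨ t / x * w ⟩ *ℂ ψ ⟨ t - t / x * w * x ⟩)
      ≈⟨ ∑-cong term ⟩
    (∑[ w ] bar χ ⟨ x ⟩ *ℂ (χ · ψ) ⟨ t ⟩ *ℂ (χ ⟨ w ⟩ *ℂ ψ ⟨ 1# - w ⟩))
      ≈⟨ ∑-*ˡ _ (λ w → χ ⟨ w ⟩ *ℂ ψ ⟨ 1# - w ⟩) ⟨
    bar χ ⟨ x ⟩ *ℂ (χ · ψ) ⟨ t ⟩ *ℂ J χ ψ
      ≈⟨ solve* 3 (λ a b c → (a ⊕ b) ⊕ c ⊜ (a ⊕ c) ⊕ b) ℂR.refl _ _ _ ⟩
    bar χ ⟨ x ⟩ *ℂ J χ ψ *ℂ (χ · ψ) ⟨ t ⟩ ∎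
    where
    open SetoidReasoning ℂR.setoid
    factor : ∀ w → t - t / x * w * x ≈ t * (1# - w)
    factor w = trans (+-congˡ (-‿cong (trans (xy∙z≈xz∙y (t / x) w x) (*-congʳ (x/y*y≈x t x≉0)))))
      (sym (x[1-y]≈x-xy t w))
    term : ∀ w → χ ⟨ t / x * w ⟩ *ℂ ψ ⟨ t - t / x * w * x ⟩ ≈ℂ
           bar χ ⟨ x ⟩ *ℂ (χ · ψ) ⟨ t ⟩ *ℂ (χ ⟨ w ⟩ *ℂ ψ ⟨ 1# - w ⟩)
    term w = begin
      χ ⟨ t / x * w ⟩ *ℂ ψ ⟨ t - t / x * w * x ⟩
        ≈⟨ ℂR.*-cong (ℂR.trans (homo χ (t / x) w) (ℂR.*-congʳ (homo χ t (x ⁻¹))))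
             (ℂR.trans (cong ψ (factor w)) (homo ψ t (1# - w))) ⟩
      χ ⟨ t ⟩ *ℂ χ ⟨ x ⁻¹ ⟩ *ℂ χ ⟨ w ⟩ *ℂ (ψ ⟨ t ⟩ *ℂ ψ ⟨ 1# - w ⟩)
        ≈⟨ solve* 5 (λ a b c d e → ((a ⊕ b) ⊕ c) ⊕ (d ⊕ e) ⊜ (b ⊕ (a ⊕ d)) ⊕ (c ⊕ e))
             ℂR.refl _ _ _ _ _ ⟩
      bar χ ⟨ x ⟩ *ℂ (χ · ψ) ⟨ t ⟩ *ℂ (χ ⟨ w ⟩ *ℂ ψ ⟨ 1# - w ⟩) ∎

  -- Here the argument of `ψ` is the product of - x and u, so the summand is a constant times a
  -- single character.
  ∑-linear-0 : ∀ χ ψ x {t} → t ≈ 0# →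
               (∑[ u ] χ ⟨ u ⟩ *ℂ ψ ⟨ t - u * x ⟩) ≈ℂ ψ ⟨ - x ⟩ *ℂ ∑ ((χ · ψ) ⟨_⟩)
  ∑-linear-0 χ ψ x {t} t≈0 = ℂR.trans (∑-cong term) (ℂR.sym (∑-*ˡ _ ((χ · ψ) ⟨_⟩)))
    where
    open SetoidReasoning ℂR.setoid
    factor : ∀ u → t - u * x ≈ - x * u
    factor u = trans (+-cong t≈0 (-‿cong (*-comm u x)))
      (trans (+-identityˡ _) (𝔽.-‿distribˡ-* x u))
    term : ∀ u → χ ⟨ u ⟩ *ℂ ψ ⟨ t - u * x ⟩ ≈ℂ ψ ⟨ - x ⟩ *ℂ (χ · ψ) ⟨ u ⟩
    term u = begin
      χ ⟨ u ⟩ *ℂ ψ ⟨ t - u * x ⟩                 ≈⟨ ℂR.*-congˡ (ℂR.trans (cong ψ (factor u)) (homo ψ (- x) u)) ⟩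
      χ ⟨ u ⟩ *ℂ (ψ ⟨ - x ⟩ *ℂ ψ ⟨ u ⟩)          ≈⟨ solve* 3 (λ a b c → a ⊕ (b ⊕ c) ⊜ b ⊕ (a ⊕ c))
                                                      ℂR.refl _ _ _ ⟩
      ψ ⟨ - x ⟩ *ℂ (χ · ψ) ⟨ u ⟩                 ∎

  -- The two characters are inverse to each other. The computation produces the sum of `B · bar A`,
  -- while `δ` is evaluated at `A · bar B`.
  ∑-swap-bar : ∀ χ ψ → ∑ ((χ · bar ψ) ⟨_⟩) ≈ℂ ∑ ((ψ · bar χ) ⟨_⟩)
  ∑-swap-bar χ ψ = ℂR.trans (∑-bar (χ · bar ψ))
    (∑-cong {bar (χ · bar ψ) ⟨_⟩} {(ψ · bar χ) ⟨_⟩} swap)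
    where
    swap : bar (χ · bar ψ) ≋ ψ · bar χ
    swap u = ℂR.trans (ℂR.*-comm (χ ⟨ u ⁻¹ ⟩) (ψ ⟨ u ⁻¹ ⁻¹ ⟩)) (ℂR.*-congʳ (bar-bar ψ u))

  -- The factor `1ℂ` is kept because it is the value of `δ` in this case, as `0ℂ` is in the next
  -- lemma; either one becomes the `d` of `F₂-reduction`.
  ∑-quotient-trivial : ∀ χ ψ → ψ · bar χ ≋ ε →
                       ∑ ((χ · bar ψ) ⟨_⟩) ≈ℂ (fromℕ q -ℂ 1ℂ) *ℂ 1ℂ
  ∑-quotient-trivial χ ψ trivial = ℂR.trans (∑-swap-bar χ ψ) (ℂR.trans
    (∑-cong {(ψ · bar χ) ⟨_⟩} {ε ⟨_⟩} trivial) (ℂR.trans ∑ε≈q-1 (ℂR.sym (ℂR.*-identityʳ _))))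

  ∑-quotient-nontrivial : ∀ χ ψ → ¬ (ψ · bar χ ≋ ε) →
                          ∑ ((χ · bar ψ) ⟨_⟩) ≈ℂ (fromℕ q -ℂ 1ℂ) *ℂ 0ℂ
  ∑-quotient-nontrivial χ ψ nontrivial = ℂR.trans (∑-swap-bar χ ψ) (ℂR.trans
    (∑-nontrivial (ψ · bar χ) nontrivial) (ℂR.sym (ℂR.zeroʳ _)))

  -- The substitution u = (1 - w)⁻¹ turns A(u) B⁻¹(u) B(1 - u) into B(-1) B(w) A⁻¹(1 - w).  Since 0 ⁻¹ = 0, it is a
  -- bijection of all of F, and both sides vanish at w = 1.
  binom-J : ∀ A B → binom (A · bar B) (bar B) ≈ℂ J B (bar A)
  binom-J A B = begin
    m⁻ *ℂ J (A · bar B) (bar (bar B))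
      ≈⟨ ℂR.*-congˡ (∑-reindex
           (λ p → ℂR.*-cong (cong (A · bar B) p) (cong (bar (bar B)) (+-congˡ (-‿cong p))))
           (λ w → (1# - w) ⁻¹) (λ u → 1# - u ⁻¹)
           (λ p → ⁻¹-cong (+-congˡ (-‿cong p))) (λ p → +-congˡ (-‿cong (⁻¹-cong p)))
           (λ u → trans (⁻¹-cong (1-[1-x]≈x (u ⁻¹))) (⁻¹-involutive u))
           (λ w → trans (+-congˡ (-‿cong (⁻¹-involutive (1# - w)))) (1-[1-x]≈x w))) ⟩
    m⁻ *ℂ (∑[ w ] (A · bar B) ⟨ (1# - w) ⁻¹ ⟩ *ℂ bar (bar B) ⟨ 1# - (1# - w) ⁻¹ ⟩)
      ≈⟨ ℂR.*-congˡ (∑-cong λ w → term w ((1# - w) ≟ 0#)) ⟩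
    m⁻ *ℂ (∑[ w ] m *ℂ (B ⟨ w ⟩ *ℂ bar A ⟨ 1# - w ⟩))
      ≈⟨ ℂR.*-congˡ (∑-*ˡ m (λ w → B ⟨ w ⟩ *ℂ bar A ⟨ 1# - w ⟩)) ⟨
    m⁻ *ℂ (m *ℂ J B (bar A))
      ≈⟨ solve* 3 (λ a b c → a ⊕ (b ⊕ c) ⊜ (b ⊕ a) ⊕ c) ℂR.refl _ _ _ ⟩
    m *ℂ m⁻ *ℂ J B (bar A)
      ≈⟨ ℂR.trans (ℂR.*-congʳ (χ[x]χ[x⁻¹]≈1 B -1≉0)) (ℂR.*-identityˡ _) ⟩
    J B (bar A) ∎
    where
    open SetoidReasoning ℂR.setoid
    m m⁻ : ℂ
    m = B ⟨ - 1# ⟩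
    m⁻ = bar B ⟨ - 1# ⟩
    term : ∀ w → Dec (1# - w ≈ 0#) →
           (A · bar B) ⟨ (1# - w) ⁻¹ ⟩ *ℂ bar (bar B) ⟨ 1# - (1# - w) ⁻¹ ⟩ ≈ℂ
           m *ℂ (B ⟨ w ⟩ *ℂ bar A ⟨ 1# - w ⟩)
    term w (yes r≈0) = ℂR.trans (0*≈0 _ (vanish (bar (A · bar B)) r≈0))
      (ℂR.sym (*0≈0 _ (*0≈0 _ (vanish (bar A) r≈0))))
    term w (no r≉0) = begin
      A ⟨ r ⁻¹ ⟩ *ℂ B ⟨ r ⁻¹ ⁻¹ ⟩ *ℂ B ⟨ (1# - r ⁻¹) ⁻¹ ⁻¹ ⟩
        ≈⟨ ℂR.*-cong (ℂR.*-congˡ (bar-bar B r)) (bar-bar B (1# - r ⁻¹)) ⟩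
      A ⟨ r ⁻¹ ⟩ *ℂ B ⟨ r ⟩ *ℂ B ⟨ 1# - r ⁻¹ ⟩
        ≈⟨ ℂR.trans (ℂR.*-assoc _ _ _) (ℂR.*-congˡ (ℂR.sym (homo B r (1# - r ⁻¹)))) ⟩
      A ⟨ r ⁻¹ ⟩ *ℂ B ⟨ r * (1# - r ⁻¹) ⟩
        ≈⟨ ℂR.*-congˡ (ℂR.trans (cong B r[1-r⁻¹]≈-w) (homo-neg B w)) ⟩
      A ⟨ r ⁻¹ ⟩ *ℂ (m *ℂ B ⟨ w ⟩)
        ≈⟨ solve* 3 (λ a b c → a ⊕ (b ⊕ c) ⊜ b ⊕ (c ⊕ a)) ℂR.refl _ _ _ ⟩
      m *ℂ (B ⟨ w ⟩ *ℂ A ⟨ r ⁻¹ ⟩) ∎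
      where
      r : Carrier
      r = 1# - w
      r[1-r⁻¹]≈-w : r * (1# - r ⁻¹) ≈ - w
      r[1-r⁻¹]≈-w = trans (x[1-y]≈x-xy r (r ⁻¹)) (trans (+-congˡ (-‿cong (⁻¹-inverseʳ r≉0)))
        (𝔽.xyx⁻¹≈y 1# (- w)))

  -- Factorisations at the exceptional points u = 1 and v = 1/y.

  ·-bar-nonzero : ∀ χ {x} → ¬ (x ≈ 0#) → (bar χ · χ) ⟨ x ⟩ ≈ℂ 1ℂ
  ·-bar-nonzero χ {x} x≉0 =
    ℂR.trans (ℂR.*-comm (χ ⟨ x ⁻¹ ⟩) (χ ⟨ x ⟩)) (χ[x]χ[x⁻¹]≈1 χ x≉0)

  -- Source of the argument y / (1 - x): it is what remains of the linear form at u = 1 once 1 - x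
  -- is taken out. The product `1# * x` is what substituting u = `1#` leaves.
  1-x-yv : ∀ {x} → ¬ (x ≈ 1#) → ∀ y v → 1# - 1# * x - v * y ≈ (1# - x) * (1# - y / (1# - x) * v)
  1-x-yv {x} x≉1 y v = sym (begin
    (1# - x) * (1# - y / (1# - x) * v)          ≈⟨ x[1-y]≈x-xy (1# - x) (y / (1# - x) * v) ⟩
    1# - x - (1# - x) * (y / (1# - x) * v)      ≈⟨ +-cong (+-congˡ (-‿cong (sym (*-identityˡ x)))) (-‿cong (begin
      (1# - x) * (y / (1# - x) * v)             ≈⟨ *-assoc (1# - x) (y / (1# - x)) v ⟨
      (1# - x) * (y / (1# - x)) * v             ≈⟨ *-congʳ (*-comm (1# - x) (y / (1# - x))) ⟩
      y / (1# - x) * (1# - x) * v               ≈⟨ *-congʳ (x/y*y≈x y (1-x≉0 x≉1)) ⟩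
      y * v                                     ≈⟨ *-comm y v ⟩
      v * y                                     ∎)) ⟩
    1# - 1# * x - v * y                         ∎)
    where open SetoidReasoning setoid

  -- Lets a character at 1 - 1/y be split into its values at -1, 1 - y and 1/y.
  1-y⁻¹ : ∀ {y} → ¬ (y ≈ 0#) → 1# - y ⁻¹ ≈ - 1# * (1# - y) * y ⁻¹
  1-y⁻¹ {y} y≉0 = sym (begin
    - 1# * (1# - y) * y ⁻¹          ≈⟨ *-congʳ (trans (𝔽.-1*x≈-x (1# - y)) (𝔽.⁻¹-anti-homo‿- 1# y)) ⟩
    (y - 1#) * y ⁻¹                 ≈⟨ 𝔽.[y-z]x≈yx-zx (y ⁻¹) y 1# ⟩
    y * y ⁻¹ - 1# * y ⁻¹            ≈⟨ +-cong (⁻¹-inverseʳ y≉0) (-‿cong (*-identityˡ (y ⁻¹))) ⟩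
    1# - y ⁻¹                       ∎)
    where open SetoidReasoning setoid

  -- The identity for nonzero `x` and `y`.

  module Reduction (A B B′ C′ : Character) {x y : Carrier}
                   (x≉0 : ¬ (x ≈ 0#)) (y≉0 : ¬ (y ≈ 0#)) (x≉1 : ¬ (x ≈ 1#)) where
    open SetoidReasoning ℂR.setoid

    χ : Character
    χ = bar B′ · C′

    -- The double sum is read in both orders: `G` is the inner sum over v for fixed u, and `H` the
    -- inner sum over u, with t in the role of 1 - v y.
    w G H : Carrier → ℂ
    w v = B′ ⟨ v ⟩ *ℂ χ ⟨ 1# - v ⟩
    G u = ∑[ v ] w v *ℂ bar A ⟨ 1# - u * x - v * y ⟩
    H t = ∑[ u ] B ⟨ u ⟩ *ℂ bar A ⟨ t - u * x ⟩

    -- The sums inside the two ₂F₁ values, without `ε` and the sign.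
    T₁ T₂ : ℂ
    T₁ = ∑[ v ] w v *ℂ bar A ⟨ 1# - y / (1# - x) * v ⟩
    T₂ = ∑[ v ] w v *ℂ bar (A · bar B) ⟨ 1# - y * v ⟩

    w-cong : ∀ {u v} → u ≈ v → w u ≈ℂ w v
    w-cong p = ℂR.*-cong (cong B′ p) (cong χ (+-congˡ (-‿cong p)))

    G-cong : ∀ {u v} → u ≈ v → G u ≈ℂ G v
    G-cong p = ∑-cong λ v → ℂR.*-congˡ {w v}
      (cong (bar A) (+-congʳ { - (v * y)} (+-congˡ (-‿cong (*-congʳ p)))))

    H-cong : ∀ {s t} → s ≈ t → H s ≈ℂ H t
    H-cong p = ∑-cong λ u → ℂR.*-congˡ {B ⟨ u ⟩} (cong (bar A) (+-congʳ { - (u * x)} p))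

    -- The double sum of `F₂ A B B′ B C′ x y`, with its factors in the order of the definition.
    L : ℂ
    L = ∑[ u ] ∑[ v ] B ⟨ u ⟩ *ℂ B′ ⟨ v ⟩ *ℂ (bar B · B) ⟨ 1# - u ⟩ *ℂ χ ⟨ 1# - v ⟩
                      *ℂ bar A ⟨ 1# - u * x - v * y ⟩

    G[1] : G 1# ≈ℂ bar A ⟨ 1# - x ⟩ *ℂ T₁
    G[1] = begin
      G 1#
        ≈⟨ ∑-cong (λ v → ℂR.trans
             (ℂR.*-congˡ (ℂR.trans (cong (bar A) (1-x-yv x≉1 y v)) (homo (bar A) (1# - x) _)))
             (solve* 3 (λ a b c → a ⊕ (b ⊕ c) ⊜ b ⊕ (a ⊕ c)) ℂR.refl (w v) _ _)) ⟩
      (∑[ v ] bar A ⟨ 1# - x ⟩ *ℂ (w v *ℂ bar A ⟨ 1# - y / (1# - x) * v ⟩))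
        ≈⟨ ∑-*ˡ (bar A ⟨ 1# - x ⟩) (λ v → w v *ℂ bar A ⟨ 1# - y / (1# - x) * v ⟩) ⟨
      bar A ⟨ 1# - x ⟩ *ℂ T₁ ∎

    -- Off u = 1 the factor `(bar B · B) ⟨ 1# - u ⟩` is 1, and at u = 1 it is 0. Hence `L` is the
    -- full sum short of its term at u = 1, where `B` is 1.
    ∑BG≈G[1]+L : (∑[ u ] B ⟨ u ⟩ *ℂ G u) ≈ℂ bar A ⟨ 1# - x ⟩ *ℂ T₁ +ℂ L
    ∑BG≈G[1]+L = begin
      (∑[ u ] B ⟨ u ⟩ *ℂ G u)
        ≈⟨ ∑-puncture {λ u → B ⟨ u ⟩ *ℂ G u} {λ u → B ⟨ u ⟩ *ℂ (bar B · B) ⟨ 1# - u ⟩ *ℂ G u}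
             (λ p → ℂR.*-cong (cong B p) (G-cong p))
             (λ p → ℂR.*-cong (ℂR.*-cong (cong B p) (cong (bar B · B) (+-congˡ (-‿cong p)))) (G-cong p))
             1#
             (λ u u≉1 → ℂR.*-congʳ (ℂR.sym (ℂR.trans
               (ℂR.*-congˡ (·-bar-nonzero B (1-x≉0 u≉1))) (ℂR.*-identityʳ (B ⟨ u ⟩)))))
             (0*≈0 (G 1#) (*0≈0 (B ⟨ 1# ⟩) (vanish (bar B · B) (-‿inverseʳ 1#)))) ⟩
      B ⟨ 1# ⟩ *ℂ G 1# +ℂ (∑[ u ] B ⟨ u ⟩ *ℂ (bar B · B) ⟨ 1# - u ⟩ *ℂ G u)
        ≈⟨ ℂR.+-cong (ℂR.trans (ℂR.*-congʳ (at-1 B)) (ℂR.trans (ℂR.*-identityˡ (G 1#)) G[1]))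
             (∑-cong λ u → ℂR.trans
               (∑-*ˡ (B ⟨ u ⟩ *ℂ (bar B · B) ⟨ 1# - u ⟩) (λ v → w v *ℂ bar A ⟨ 1# - u * x - v * y ⟩))
               (∑-cong λ v → regroup (B ⟨ u ⟩) ((bar B · B) ⟨ 1# - u ⟩) (B′ ⟨ v ⟩) (χ ⟨ 1# - v ⟩)
                 (bar A ⟨ 1# - u * x - v * y ⟩))) ⟩
      bar A ⟨ 1# - x ⟩ *ℂ T₁ +ℂ L ∎
      where
      regroup : ∀ a b c d e → a *ℂ b *ℂ (c *ℂ d *ℂ e) ≈ℂ a *ℂ c *ℂ b *ℂ d *ℂ e
      regroup = solve* 5 (λ a b c d e → (a ⊕ b) ⊕ ((c ⊕ d) ⊕ e) ⊜ (((a ⊕ c) ⊕ b) ⊕ d) ⊕ e) ℂR.refl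

    ∑BG≈∑wH : (∑[ u ] B ⟨ u ⟩ *ℂ G u) ≈ℂ (∑[ v ] w v *ℂ H (1# - v * y))
    ∑BG≈∑wH = begin
      (∑[ u ] B ⟨ u ⟩ *ℂ G u)
        ≈⟨ ∑-cong (λ u → ∑-*ˡ (B ⟨ u ⟩) (λ v → w v *ℂ bar A ⟨ 1# - u * x - v * y ⟩)) ⟩
      (∑[ u ] ∑[ v ] B ⟨ u ⟩ *ℂ (w v *ℂ bar A ⟨ 1# - u * x - v * y ⟩))
        ≈⟨ ∑-swap (λ u v → B ⟨ u ⟩ *ℂ (w v *ℂ bar A ⟨ 1# - u * x - v * y ⟩)) ⟩
      (∑[ v ] ∑[ u ] B ⟨ u ⟩ *ℂ (w v *ℂ bar A ⟨ 1# - u * x - v * y ⟩))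
        -- Subtracting v y before u x exposes the inner sum as `H` at 1 - v y.
        ≈⟨ ∑-cong (λ v → ∑-cong λ u → ℂR.trans (exchange (B ⟨ u ⟩) (w v) _)
             (ℂR.*-congˡ (ℂR.*-congˡ (cong (bar A) (reorder (u * x) (v * y)))))) ⟩
      (∑[ v ] ∑[ u ] w v *ℂ (B ⟨ u ⟩ *ℂ bar A ⟨ 1# - v * y - u * x ⟩))
        ≈⟨ ∑-cong (λ v → ∑-*ˡ (w v) (λ u → B ⟨ u ⟩ *ℂ bar A ⟨ 1# - v * y - u * x ⟩)) ⟨
      (∑[ v ] w v *ℂ H (1# - v * y)) ∎
      where
      exchange : ∀ a b c → a *ℂ (b *ℂ c) ≈ℂ b *ℂ (a *ℂ c)
      exchange = solve* 3 (λ a b c → a ⊕ (b ⊕ c) ⊜ b ⊕ (a ⊕ c)) ℂR.refl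
      reorder : ∀ s t → 1# - s - t ≈ 1# - t - s
      reorder s t = trans (+-assoc 1# (- s) (- t))
        (trans (+-congˡ (+-comm (- s) (- t))) (sym (+-assoc 1# (- t) (- s))))

    -- `∑-linear` evaluates `H` except where 1 - v y = 0, that is at v = 1/y. There its closed form
    -- would give 0, and `∑-linear-0` supplies the true value as a separate term.
    ∑wH : (∑[ v ] w v *ℂ H (1# - v * y)) ≈ℂ
          w (y ⁻¹) *ℂ (bar A ⟨ - x ⟩ *ℂ ∑ ((B · bar A) ⟨_⟩)) +ℂ bar B ⟨ x ⟩ *ℂ J B (bar A) *ℂ T₂
    ∑wH = begin
      (∑[ v ] w v *ℂ H (1# - v * y))
        ≈⟨ ∑-puncture {λ v → w v *ℂ H (1# - v * y)} {λ v → w v *ℂ (c₀ *ℂ (B · bar A) ⟨ 1# - v * y ⟩)}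
             (λ p → ℂR.*-cong (w-cong p) (H-cong (+-congˡ (-‿cong (*-congʳ p)))))
             (λ p → ℂR.*-cong (w-cong p)
               (ℂR.*-congˡ (cong (B · bar A) (+-congˡ (-‿cong (*-congʳ p))))))
             (y ⁻¹)
             (λ v v≉y⁻¹ → ℂR.*-congˡ (∑-linear B (bar A) x≉0 (1-x≉0 λ vy≈1 →
               v≉y⁻¹ (⁻¹-unique (trans (*-comm y v) vy≈1)))))
             (*0≈0 (w (y ⁻¹)) (*0≈0 c₀ (vanish (B · bar A) 1-y⁻¹y≈0))) ⟩
      w (y ⁻¹) *ℂ H (1# - y ⁻¹ * y) +ℂ (∑[ v ] w v *ℂ (c₀ *ℂ (B · bar A) ⟨ 1# - v * y ⟩))
        ≈⟨ ℂR.+-cong (ℂR.*-congˡ (∑-linear-0 B (bar A) x 1-y⁻¹y≈0)) (∑-cong term) ⟩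
      w (y ⁻¹) *ℂ (bar A ⟨ - x ⟩ *ℂ ∑ ((B · bar A) ⟨_⟩)) +ℂ
      (∑[ v ] c₀ *ℂ (w v *ℂ bar (A · bar B) ⟨ 1# - y * v ⟩))
        ≈⟨ ℂR.+-congˡ (∑-*ˡ c₀ (λ v → w v *ℂ bar (A · bar B) ⟨ 1# - y * v ⟩)) ⟨
      w (y ⁻¹) *ℂ (bar A ⟨ - x ⟩ *ℂ ∑ ((B · bar A) ⟨_⟩)) +ℂ c₀ *ℂ T₂ ∎
      where
      c₀ : ℂ
      c₀ = bar B ⟨ x ⟩ *ℂ J B (bar A)
      1-y⁻¹y≈0 : 1# - y ⁻¹ * y ≈ 0#
      1-y⁻¹y≈0 = 𝔽.x≈y⇒x∙y⁻¹≈ε (sym (trans (*-comm (y ⁻¹) y) (⁻¹-inverseʳ y≉0)))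
      regroup : ∀ a b c d → a *ℂ (b *ℂ (c *ℂ d)) ≈ℂ b *ℂ (a *ℂ (d *ℂ c))
      regroup = solve* 4 (λ a b c d → a ⊕ (b ⊕ (c ⊕ d)) ⊜ b ⊕ (a ⊕ (d ⊕ c))) ℂR.refl
      term : ∀ v → w v *ℂ (c₀ *ℂ (B · bar A) ⟨ 1# - v * y ⟩) ≈ℂ
             c₀ *ℂ (w v *ℂ bar (A · bar B) ⟨ 1# - y * v ⟩)
      term v = ℂR.trans (regroup (w v) c₀ (B ⟨ 1# - v * y ⟩) (A ⟨ (1# - v * y) ⁻¹ ⟩))
        (ℂR.*-congˡ (ℂR.*-congˡ (ℂR.trans
          -- `bar (A · bar B)` at z unfolds to `A` at the inverse of z times `B` at its double
          -- inverse, so only the latter has to be introduced.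
          (ℂR.*-congˡ (ℂR.sym (bar-bar B (1# - v * y))))
          (cong (bar (A · bar B)) (+-congˡ (-‿cong (*-comm v y)))))))

    k : ℂ
    k = (B′ · C′) ⟨ - 1# ⟩

    -- Splitting `χ` at 1 - 1/y by `1-y⁻¹` makes the values of `B′` and `bar B′` at -1 and at 1/y
    -- cancel and squares `C′ ⟨ - 1# ⟩` to 1. Of the values at 1/y only that of `C′` survives.
    k*w[y⁻¹] : k *ℂ w (y ⁻¹) ≈ℂ bar C′ ⟨ y ⟩ *ℂ χ ⟨ 1# - y ⟩
    k*w[y⁻¹] = begin
      b *ℂ c *ℂ (B′ ⟨ y ⁻¹ ⟩ *ℂ χ ⟨ 1# - y ⁻¹ ⟩)
        ≈⟨ ℂR.*-congˡ (ℂR.*-congˡ (ℂR.trans (cong χ (1-y⁻¹ y≉0)) (ℂR.trans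
             (homo χ (- 1# * (1# - y)) (y ⁻¹)) (ℂR.*-congʳ (homo χ (- 1#) (1# - y)))))) ⟩
      b *ℂ c *ℂ (s *ℂ (b⁻ *ℂ c *ℂ χ₁ *ℂ (s⁻ *ℂ t)))
        ≈⟨ regroup b b⁻ c s s⁻ t χ₁ ⟩
      b *ℂ b⁻ *ℂ (c *ℂ c) *ℂ (s *ℂ s⁻) *ℂ (t *ℂ χ₁)
        ≈⟨ ℂR.*-congʳ (ℂR.*-cong (ℂR.*-cong (χ[x]χ[x⁻¹]≈1 B′ -1≉0) (χ[-1]²≈1 C′))
             (χ[x]χ[x⁻¹]≈1 B′ (⁻¹-nonzero y≉0))) ⟩
      1ℂ *ℂ 1ℂ *ℂ 1ℂ *ℂ (t *ℂ χ₁)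
        ≈⟨ solve* 2 (λ a b → ((id ⊕ id) ⊕ id) ⊕ (a ⊕ b) ⊜ a ⊕ b) ℂR.refl t χ₁ ⟩
      t *ℂ χ₁ ∎
      where
      b b⁻ c s s⁻ t χ₁ : ℂ
      b = B′ ⟨ - 1# ⟩
      b⁻ = bar B′ ⟨ - 1# ⟩
      c = C′ ⟨ - 1# ⟩
      s = B′ ⟨ y ⁻¹ ⟩
      s⁻ = bar B′ ⟨ y ⁻¹ ⟩
      t = C′ ⟨ y ⁻¹ ⟩
      χ₁ = χ ⟨ 1# - y ⟩
      regroup : ∀ b b⁻ c s s⁻ t χ₁ →
        b *ℂ c *ℂ (s *ℂ (b⁻ *ℂ c *ℂ χ₁ *ℂ (s⁻ *ℂ t))) ≈ℂ
        b *ℂ b⁻ *ℂ (c *ℂ c) *ℂ (s *ℂ s⁻) *ℂ (t *ℂ χ₁)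
      regroup = solve* 7 (λ b b⁻ c s s⁻ t χ₁ →
        (b ⊕ c) ⊕ (s ⊕ (((b⁻ ⊕ c) ⊕ χ₁) ⊕ (s⁻ ⊕ t))) ⊜
        (((b ⊕ b⁻) ⊕ (c ⊕ c)) ⊕ (s ⊕ s⁻)) ⊕ (t ⊕ χ₁)) ℂR.refl

    -- `B ⟨ - 1# ⟩` occurs twice because C = `B`, and its square is 1. What is left is the sign
    -- shared by both ₂F₁ values.
    sign : (B · B′ · B · C′) ⟨ - 1# ⟩ ≈ℂ k
    sign = begin
      b *ℂ b′ *ℂ b *ℂ c       ≈⟨ solve* 3 (λ b b′ c → ((b ⊕ b′) ⊕ b) ⊕ c ⊜ (b ⊕ b) ⊕ (b′ ⊕ c)) ℂR.refl b b′ c ⟩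
      b *ℂ b *ℂ (b′ *ℂ c)     ≈⟨ ℂR.trans (ℂR.*-congʳ (χ[-1]²≈1 B)) (ℂR.*-identityˡ k) ⟩
      b′ *ℂ c                 ∎
      where
      b b′ c : ℂ
      b = B ⟨ - 1# ⟩
      b′ = B′ ⟨ - 1# ⟩
      c = C′ ⟨ - 1# ⟩

    -- The sum of `B · bar A` enters through an abstract multiple `d` of q - 1, so the calculation
    -- never inspects `δ`.
    reduction : ∀ {d} → ∑ ((B · bar A) ⟨_⟩) ≈ℂ (fromℕ q -ℂ 1ℂ) *ℂ d →
      F₂ A B B′ B C′ x y ≈ℂ
        -ℂ (ε ⟨ x ⟩ *ℂ bar A ⟨ 1# - x ⟩ *ℂ ₂F₁ A B′ C′ (y / (1# - x)))
        +ℂ bar B ⟨ x ⟩ *ℂ binom (A · bar B) (bar B) *ℂ ₂F₁ (A · bar B) B′ C′ y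
        +ℂ (fromℕ q -ℂ 1ℂ) *ℂ d *ℂ bar A ⟨ - x ⟩ *ℂ bar C′ ⟨ y ⟩ *ℂ χ ⟨ 1# - y ⟩
    reduction {d} ∑BĀ≈Qd = begin
      ε ⟨ x * y ⟩ *ℂ (B · B′ · B · C′) ⟨ - 1# ⟩ *ℂ L
        ≈⟨ ℂR.*-congʳ (ℂR.trans (ℂR.*-cong (ε-one (*-nonzero x≉0 y≉0)) sign) (ℂR.*-identityˡ k)) ⟩
      k *ℂ L
        ≈⟨ \\-leftDividesʳ (k *ℂ (a₁ *ℂ T₁)) (k *ℂ L) ⟨
      -- The u = 1 term is subtracted and added, which completes `L` to the full sum over u.
      -ℂ (k *ℂ (a₁ *ℂ T₁)) +ℂ (k *ℂ (a₁ *ℂ T₁) +ℂ k *ℂ L)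
        ≈⟨ ℂR.+-congˡ (ℂR.distribˡ k (a₁ *ℂ T₁) L) ⟨
      -ℂ (k *ℂ (a₁ *ℂ T₁)) +ℂ k *ℂ (a₁ *ℂ T₁ +ℂ L)
        ≈⟨ ℂR.+-congˡ (ℂR.*-congˡ (ℂR.trans (ℂR.sym ∑BG≈G[1]+L) (ℂR.trans ∑BG≈∑wH ∑wH))) ⟩
      -ℂ (k *ℂ (a₁ *ℂ T₁)) +ℂ k *ℂ (w (y ⁻¹) *ℂ (a₂ *ℂ ∑ ((B · bar A) ⟨_⟩)) +ℂ b⁻ *ℂ j *ℂ T₂)
        ≈⟨ ℂR.+-congˡ (ℂR.*-congˡ (ℂR.+-congʳ (ℂR.*-congˡ (ℂR.*-congˡ ∑BĀ≈Qd)))) ⟩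
      -ℂ (k *ℂ (a₁ *ℂ T₁)) +ℂ k *ℂ (w (y ⁻¹) *ℂ (a₂ *ℂ (Q *ℂ d)) +ℂ b⁻ *ℂ j *ℂ T₂)
        ≈⟨ ℂR.+-congˡ (expand k (w (y ⁻¹)) a₂ Q d b⁻ j T₂) ⟩
      -ℂ (k *ℂ (a₁ *ℂ T₁)) +ℂ (b⁻ *ℂ j *ℂ (k *ℂ T₂) +ℂ Q *ℂ d *ℂ a₂ *ℂ (k *ℂ w (y ⁻¹)))
        ≈⟨ ℂR.+-assoc _ _ _ ⟨
      -ℂ (k *ℂ (a₁ *ℂ T₁)) +ℂ b⁻ *ℂ j *ℂ (k *ℂ T₂) +ℂ Q *ℂ d *ℂ a₂ *ℂ (k *ℂ w (y ⁻¹))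
        ≈⟨ ℂR.+-cong (ℂR.+-cong (ℂR.-‿cong first) second) third ⟩
      -ℂ (ε ⟨ x ⟩ *ℂ a₁ *ℂ ₂F₁ A B′ C′ (y / (1# - x)))
      +ℂ b⁻ *ℂ binom (A · bar B) (bar B) *ℂ ₂F₁ (A · bar B) B′ C′ y
      +ℂ Q *ℂ d *ℂ a₂ *ℂ bar C′ ⟨ y ⟩ *ℂ χ ⟨ 1# - y ⟩ ∎
      where
      a₁ a₂ b⁻ j Q : ℂ
      a₁ = bar A ⟨ 1# - x ⟩
      a₂ = bar A ⟨ - x ⟩
      b⁻ = bar B ⟨ x ⟩
      j = J B (bar A)
      Q = fromℕ q -ℂ 1ℂ
      expand : ∀ k w a₂ Q d b⁻ j T₂ → k *ℂ (w *ℂ (a₂ *ℂ (Q *ℂ d)) +ℂ b⁻ *ℂ j *ℂ T₂) ≈ℂ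
               b⁻ *ℂ j *ℂ (k *ℂ T₂) +ℂ Q *ℂ d *ℂ a₂ *ℂ (k *ℂ w)
      expand = solve 8 (λ k w a₂ Q d b⁻ j T₂ → k :* (w :* (a₂ :* (Q :* d)) :+ b⁻ :* j :* T₂) :=
               b⁻ :* j :* (k :* T₂) :+ Q :* d :* a₂ :* (k :* w)) ℂR.refl
      first : k *ℂ (a₁ *ℂ T₁) ≈ℂ ε ⟨ x ⟩ *ℂ a₁ *ℂ (ε ⟨ y / (1# - x) ⟩ *ℂ k *ℂ T₁)
      first = begin
        k *ℂ (a₁ *ℂ T₁)
          ≈⟨ solve* 3 (λ k a t → k ⊕ (a ⊕ t) ⊜ (id ⊕ a) ⊕ ((id ⊕ k) ⊕ t)) ℂR.refl k a₁ T₁ ⟩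
        -- The inserted units are the values of `ε` at `x` and at y / (1 - x), both arguments being
        -- nonzero.
        1ℂ *ℂ a₁ *ℂ (1ℂ *ℂ k *ℂ T₁)
          ≈⟨ ℂR.*-cong (ℂR.*-congʳ (ε-one x≉0))
               (ℂR.*-congʳ (ℂR.*-congʳ (ε-one (*-nonzero y≉0 (⁻¹-nonzero (1-x≉0 x≉1)))))) ⟨
        ε ⟨ x ⟩ *ℂ a₁ *ℂ (ε ⟨ y / (1# - x) ⟩ *ℂ k *ℂ T₁) ∎
      second : b⁻ *ℂ j *ℂ (k *ℂ T₂) ≈ℂ b⁻ *ℂ binom (A · bar B) (bar B) *ℂ (ε ⟨ y ⟩ *ℂ k *ℂ T₂)
      second = ℂR.*-cong (ℂR.*-congˡ (ℂR.sym (binom-J A B)))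
        (ℂR.*-congʳ (ℂR.sym (ℂR.trans (ℂR.*-congʳ (ε-one y≉0)) (ℂR.*-identityˡ k))))
      third : Q *ℂ d *ℂ a₂ *ℂ (k *ℂ w (y ⁻¹)) ≈ℂ Q *ℂ d *ℂ a₂ *ℂ bar C′ ⟨ y ⟩ *ℂ χ ⟨ 1# - y ⟩
      third = ℂR.trans (ℂR.*-congˡ k*w[y⁻¹])
        (ℂR.sym (ℂR.*-assoc (Q *ℂ d *ℂ a₂) (bar C′ ⟨ y ⟩) (χ ⟨ 1# - y ⟩)))

  -- Vanishing arguments and the value of `δ`.

  -- If `x` or `y` is 0, both sides are 0, since every character, `ε` included, vanishes at 0;
  -- otherwise `Reduction` applies.
  F₂-reduction : ∀ A B B′ C′ {x} y {d} → ¬ (x ≈ 1#) →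
    ∑ ((B · bar A) ⟨_⟩) ≈ℂ (fromℕ q -ℂ 1ℂ) *ℂ d →
    F₂ A B B′ B C′ x y ≈ℂ
      -ℂ (ε ⟨ x ⟩ *ℂ bar A ⟨ 1# - x ⟩ *ℂ ₂F₁ A B′ C′ (y / (1# - x)))
      +ℂ bar B ⟨ x ⟩ *ℂ binom (A · bar B) (bar B) *ℂ ₂F₁ (A · bar B) B′ C′ y
      +ℂ (fromℕ q -ℂ 1ℂ) *ℂ d *ℂ bar A ⟨ - x ⟩ *ℂ bar C′ ⟨ y ⟩ *ℂ (bar B′ · C′) ⟨ 1# - y ⟩
  F₂-reduction A B B′ C′ {x} y {d} x≉1 ∑BĀ≈[q-1]d = by-cases (x ≟ 0#) (y ≟ 0#)
    where
    lhs r₁ r₂ r₃ : ℂ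
    lhs = F₂ A B B′ B C′ x y
    r₁ = ε ⟨ x ⟩ *ℂ bar A ⟨ 1# - x ⟩ *ℂ ₂F₁ A B′ C′ (y / (1# - x))
    r₂ = bar B ⟨ x ⟩ *ℂ binom (A · bar B) (bar B) *ℂ ₂F₁ (A · bar B) B′ C′ y
    r₃ = (fromℕ q -ℂ 1ℂ) *ℂ d *ℂ bar A ⟨ - x ⟩ *ℂ bar C′ ⟨ y ⟩ *ℂ (bar B′ · C′) ⟨ 1# - y ⟩

    lhs≈0 : x * y ≈ 0# → lhs ≈ℂ 0ℂ
    lhs≈0 xy≈0 = 0*≈0 _ (0*≈0 _ (vanish ε xy≈0))

    ₂F₁≈0 : ∀ A B C {z} → z ≈ 0# → ₂F₁ A B C z ≈ℂ 0ℂ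
    ₂F₁≈0 A B C z≈0 = 0*≈0 _ (0*≈0 _ (vanish ε z≈0))

    by-cases : Dec (x ≈ 0#) → Dec (y ≈ 0#) → lhs ≈ℂ -ℂ r₁ +ℂ r₂ +ℂ r₃
    by-cases (yes x≈0) _ = ℂR.trans (lhs≈0 (trans (*-congʳ x≈0) (zeroˡ y))) (ℂR.sym (-0+0+0≈0 {r₁} {r₂} {r₃}
      -- At `x` = 0 the three terms vanish through `ε ⟨ x ⟩`, `bar B ⟨ x ⟩` and `bar A ⟨ - x ⟩`.
      (0*≈0 _ (0*≈0 _ (vanish ε x≈0)))
      (0*≈0 _ (0*≈0 _ (vanish (bar B) x≈0)))
      (0*≈0 _ (0*≈0 _ (*0≈0 _ (vanish (bar A) (trans (-‿cong x≈0) 𝔽.-0#≈0#)))))))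
    by-cases (no _) (yes y≈0) = ℂR.trans (lhs≈0 (trans (*-congˡ y≈0) (zeroʳ x))) (ℂR.sym (-0+0+0≈0 {r₁} {r₂} {r₃}
      -- At `y` = 0 both ₂F₁ values have argument 0, and the last term contains `bar C′ ⟨ y ⟩`.
      (*0≈0 _ (₂F₁≈0 A B′ C′ (trans (*-congʳ y≈0) (zeroˡ _))))
      (*0≈0 _ (₂F₁≈0 (A · bar B) B′ C′ y≈0))
      (0*≈0 _ (*0≈0 _ (vanish (bar C′) y≈0)))))
    by-cases (no x≉0) (no y≉0) = Reduction.reduction A B B′ C′ x≉0 y≉0 x≉1 ∑BĀ≈[q-1]d

theorem3p2 : ∀ {c ℓ} (q : ℕ) → IsPrimePower q → (F : FiniteField q c ℓ) →
    let open FiniteField F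
        open Characters F
    in (A B B′ C′ : Character) (x y : Carrier) → ¬ (x ≈ 1#) →
       F₂ A B B′ B C′ x y ≈ℂ
         -ℂ (ε ⟨ x ⟩ *ℂ bar A ⟨ 1# - x ⟩ *ℂ ₂F₁ A B′ C′ (y / (1# - x)))
         +ℂ bar B ⟨ x ⟩ *ℂ binom (A · bar B) (bar B) *ℂ ₂F₁ (A · bar B) B′ C′ y
         +ℂ (fromℕ q -ℂ 1ℂ) *ℂ δ (A · bar B) *ℂ bar A ⟨ - x ⟩
              *ℂ bar C′ ⟨ y ⟩ *ℂ (bar B′ · C′) ⟨ 1# - y ⟩
-- Splitting on trivial? makes δ compute; comparing two occurrences of δ (A · bar B) would unfold trivial?.
theorem3p2 q _ F A B B′ C′ x y x≉1
  with Characters.trivial? F (Characters._·_ F A (Characters.bar F B))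
... | yes trivial   = F₂-reduction A B B′ C′ y x≉1 (∑-quotient-trivial B A trivial)
  where open CharacterSums F
... | no nontrivial = F₂-reduction A B B′ C′ y x≉1 (∑-quotient-nontrivial B A nontrivial)
  where open CharacterSums F
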